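{- For any unweighted graph $G=(V,E)$ on $n$ vertices, any integer $k\ge 1$, and any $c>3$ and $\delta>0$, there is a randomized algorithm that with probability at least $\left(1-\frac1c\right)\cdot\frac{\delta}{1+\delta}$ computes a spanner of $G$ with stretch $2k-1$ and number of edges at most $$(1+\delta)\cdot\frac{(cn)^{1+1/k}}{c-1}-\delta(n-1).$$
   Context: Graphs are undirected. $d_G(u,v)$ denotes the shortest-path distance in $G$. A subgraph $H=(V,E')$, $E'\subseteq E$, is a spanner of $G$ with stretch $\alpha\ge 1$ (an $\alpha$-spanner) if $d_H(u,v)\le\alpha\cdot d_G(u,v)$ for every pair $u,v\in V$. -}

module Defs where

open import Data.Bool.Base using (Bool; false; T; _∧_)
open import Data.Empty using (⊥-elim)
open import Data.Fin.Base using (Fin)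
open import Data.Fin.Properties using () renaming (_<?_ to _<F?_)
open import Data.Fin.Subset using (Subset; _∈_) renaming (∣_∣ to card)
open import Data.Integer.Base as ℤ using (+_)
import Data.Integer.Properties as ℤP
import Data.Integer.Solver as ℤS
open import Data.List.Base using (List; length; filterᵇ; cartesianProduct; allFin)
open import Data.Nat.Base as ℕ using (ℕ; zero; suc; NonZero)
import Data.Nat.Properties as ℕP
open import Data.Product.Base using (Σ-syntax; ∃-syntax; _×_; _,_)
open import Data.Rational.Base as ℚ using (ℚ; 0ℚ; 1ℚ; ½; ∣_∣)
import Data.Rational.Properties as ℚP
import Data.Rational.Unnormalised.Base as ℚᵘ
import Data.Rational.Unnormalised.Properties as ℚᵘP
open import Data.Rational.Literals using (fromℤ)
open import Data.Rational.Solver using (module +-*-Solver)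
open import Data.Sum.Base using (_⊎_; inj₁; inj₂; map₁)
open import Relation.Binary.PropositionalEquality
  using (_≡_; refl; sym; trans; cong; cong₂; subst; subst₂)
open import Relation.Nullary.Decidable using (yes; no; ⌊_⌋)
open import Relation.Nullary.Negation using (¬_)
open import Relation.Unary using (Decidable)
open +-*-Solver

private
  half+half : ∀ ε → ε ℚ.* ½ ℚ.+ ε ℚ.* ½ ≡ ε
  half+half ε = trans (sym (ℚP.*-distribˡ-+ ε ½ ½)) (ℚP.*-identityʳ ε)

  *-pos : ∀ {p q} → 0ℚ ℚ.< p → 0ℚ ℚ.< q → 0ℚ ℚ.< p ℚ.* q
  *-pos {p} {q} p>0 q>0 =
    ℚP.positive⁻¹ (p ℚ.* q)
      {{ℚP.pos*pos⇒pos p {{ℚ.positive p>0}} q {{ℚ.positive q>0}}}}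

  half-pos : ∀ {ε} → 0ℚ ℚ.< ε → 0ℚ ℚ.< ε ℚ.* ½
  half-pos ε>0 = *-pos ε>0 (ℚP.positive⁻¹ ½)

  ∣p∣≤ : ∀ {p r} → p ℚ.≤ r → ℚ.- p ℚ.≤ r → ∣ p ∣ ℚ.≤ r
  ∣p∣≤ {p} {r} p≤r -p≤r with ℚP.∣p∣≡p∨∣p∣≡-p p
  ... | inj₁ eq = subst (ℚ._≤ r) (sym eq) p≤r
  ... | inj₂ eq = subst (ℚ._≤ r) (sym eq) -p≤r

  p≤∣p∣ : ∀ p → p ℚ.≤ ∣ p ∣
  p≤∣p∣ p with ℚP.≤-total 0ℚ p
  ... | inj₁ 0≤p = ℚP.≤-reflexive (sym (ℚP.0≤p⇒∣p∣≡p 0≤p))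
  ... | inj₂ p≤0 = ℚP.≤-trans p≤0 (ℚP.0≤∣p∣ p)

  *-mono-≤-nonNeg : ∀ {p q r s} → 0ℚ ℚ.≤ p → 0ℚ ℚ.≤ s →
                    p ℚ.≤ q → r ℚ.≤ s → p ℚ.* r ℚ.≤ q ℚ.* s
  *-mono-≤-nonNeg {p} {q} {r} {s} 0≤p 0≤s p≤q r≤s = ℚP.≤-trans
    (ℚP.*-monoˡ-≤-nonNeg p {{ℚ.nonNegative 0≤p}} r≤s)
    (ℚP.*-monoʳ-≤-nonNeg s {{ℚ.nonNegative 0≤s}} p≤q)

  *-nonNeg : ∀ {p q} → 0ℚ ℚ.≤ p → 0ℚ ℚ.≤ q → 0ℚ ℚ.≤ p ℚ.* q
  *-nonNeg {p} {q} 0≤p 0≤q =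
    subst (ℚ._≤ p ℚ.* q) (ℚP.*-zeroʳ p)
      (ℚP.*-monoˡ-≤-nonNeg p {{ℚ.nonNegative 0≤p}} 0≤q)

  ≤-sub : ∀ {p q r} → p ℚ.≤ q ℚ.+ r → p ℚ.- q ℚ.≤ r
  ≤-sub {p} {q} {r} h = subst (p ℚ.- q ℚ.≤_)
    (solve 2 (λ q r → q :+ r :+ :- q := r) refl q r)
    (ℚP.+-monoˡ-≤ (ℚ.- q) h)

  sub-≤ : ∀ {p q r} → p ℚ.- q ℚ.≤ r → p ℚ.≤ q ℚ.+ r
  sub-≤ {p} {q} {r} h = subst (ℚ._≤ q ℚ.+ r)
    (solve 2 (λ p q → q :+ (p :+ :- q) := p) refl p q)
    (ℚP.+-monoʳ-≤ q h)

  id₁ : ∀ a b c d → (a ℚ.+ b) ℚ.- (c ℚ.+ d) ≡ (a ℚ.- c) ℚ.+ (b ℚ.- d)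
  id₁ = solve 4 (λ a b c d → (a :+ b) :+ :- (c :+ d) := (a :+ :- c) :+ (b :+ :- d)) refl

  id₂ : ∀ a b → a ≡ b ℚ.+ (a ℚ.- b)
  id₂ = solve 2 (λ a b → a := b :+ (a :+ :- b)) refl

  id₃ : ∀ a b c d → a ℚ.* b ℚ.- c ℚ.* d ≡ a ℚ.* (b ℚ.- d) ℚ.+ d ℚ.* (a ℚ.- c)
  id₃ = solve 4 (λ a b c d → a :* b :+ :- (c :* d) := a :* (b :+ :- d) :+ d :* (a :+ :- c)) refl

  id₄ : ∀ r s a b → (r ℚ.- s) ℚ.* (a ℚ.* b) ≡ (r ℚ.* a) ℚ.* b ℚ.- (s ℚ.* b) ℚ.* a
  id₄ = solve 4 (λ r s a b → (r :+ :- s) :* (a :* b) := (r :* a) :* b :+ :- ((s :* b) :* a)) refl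

  ∣+∣-bound : ∀ a b c d {δ ε} → ∣ a ℚ.- c ∣ ℚ.≤ δ → ∣ b ℚ.- d ∣ ℚ.≤ ε →
              ∣ (a ℚ.+ b) ℚ.- (c ℚ.+ d) ∣ ℚ.≤ δ ℚ.+ ε
  ∣+∣-bound a b c d {δ} {ε} h k = begin
    ∣ (a ℚ.+ b) ℚ.- (c ℚ.+ d) ∣       ≡⟨ cong ∣_∣ (id₁ a b c d) ⟩
    ∣ (a ℚ.- c) ℚ.+ (b ℚ.- d) ∣       ≤⟨ ℚP.∣p+q∣≤∣p∣+∣q∣ (a ℚ.- c) (b ℚ.- d) ⟩
    ∣ a ℚ.- c ∣ ℚ.+ ∣ b ℚ.- d ∣       ≤⟨ ℚP.+-mono-≤ h k ⟩
    δ ℚ.+ ε                           ∎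
    where open ℚP.≤-Reasoning

  ∣∣-bound : ∀ a b {ε} → ∣ a ℚ.- b ∣ ℚ.≤ ε → ∣ a ∣ ℚ.≤ ∣ b ∣ ℚ.+ ε
  ∣∣-bound a b {ε} h = begin
    ∣ a ∣                         ≡⟨ cong ∣_∣ (id₂ a b) ⟩
    ∣ b ℚ.+ (a ℚ.- b) ∣           ≤⟨ ℚP.∣p+q∣≤∣p∣+∣q∣ b (a ℚ.- b) ⟩
    ∣ b ∣ ℚ.+ ∣ a ℚ.- b ∣         ≤⟨ ℚP.+-monoʳ-≤ ∣ b ∣ h ⟩
    ∣ b ∣ ℚ.+ ε                   ∎
    where open ℚP.≤-Reasoning

  ∣*∣-bound : ∀ a b c d {A D δ ε} → ∣ a ∣ ℚ.≤ A → ∣ d ∣ ℚ.≤ D →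
              ∣ a ℚ.- c ∣ ℚ.≤ δ → ∣ b ℚ.- d ∣ ℚ.≤ ε →
              ∣ a ℚ.* b ℚ.- c ℚ.* d ∣ ℚ.≤ A ℚ.* ε ℚ.+ D ℚ.* δ
  ∣*∣-bound a b c d {A} {D} {δ} {ε} hA hD hδ hε = begin
    ∣ a ℚ.* b ℚ.- c ℚ.* d ∣
      ≡⟨ cong ∣_∣ (id₃ a b c d) ⟩
    ∣ a ℚ.* (b ℚ.- d) ℚ.+ d ℚ.* (a ℚ.- c) ∣
      ≤⟨ ℚP.∣p+q∣≤∣p∣+∣q∣ (a ℚ.* (b ℚ.- d)) (d ℚ.* (a ℚ.- c)) ⟩
    ∣ a ℚ.* (b ℚ.- d) ∣ ℚ.+ ∣ d ℚ.* (a ℚ.- c) ∣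
      ≡⟨ cong₂ ℚ._+_ (ℚP.∣p*q∣≡∣p∣*∣q∣ a (b ℚ.- d)) (ℚP.∣p*q∣≡∣p∣*∣q∣ d (a ℚ.- c)) ⟩
    ∣ a ∣ ℚ.* ∣ b ℚ.- d ∣ ℚ.+ ∣ d ∣ ℚ.* ∣ a ℚ.- c ∣
      ≤⟨ ℚP.+-mono-≤ (mono hA hε) (mono hD hδ) ⟩
    A ℚ.* ε ℚ.+ D ℚ.* δ ∎
    where
    open ℚP.≤-Reasoning
    mono : ∀ {p q r s} → ∣ p ∣ ℚ.≤ q → ∣ r ∣ ℚ.≤ s → ∣ p ∣ ℚ.* ∣ r ∣ ℚ.≤ q ℚ.* s
    mono {p} {_} {r} h k =
      *-mono-≤-nonNeg (ℚP.0≤∣p∣ p) (ℚP.≤-trans (ℚP.0≤∣p∣ r) k) h k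

  ∣recip∣-bound : ∀ a b r s {η ε} → r ℚ.* a ≡ 1ℚ → s ℚ.* b ≡ 1ℚ →
                  0ℚ ℚ.< η → η ℚ.≤ a → η ℚ.≤ b →
                  ∣ b ℚ.- a ∣ ℚ.≤ ε ℚ.* (η ℚ.* η) → ∣ r ℚ.- s ∣ ℚ.≤ ε
  ∣recip∣-bound a b r s {η} {ε} ra sb η>0 η≤a η≤b h =
    ℚP.*-cancelʳ-≤-pos (η ℚ.* η) {{ℚ.positive (*-pos η>0 η>0)}} (begin
    ∣ r ℚ.- s ∣ ℚ.* (η ℚ.* η)
      ≤⟨ ℚP.*-monoˡ-≤-nonNeg ∣ r ℚ.- s ∣ {{ℚP.∣-∣-nonNeg (r ℚ.- s)}}
           (*-mono-≤-nonNeg (ℚP.<⇒≤ η>0) (ℚP.<⇒≤ 0<b) η≤a η≤b) ⟩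
    ∣ r ℚ.- s ∣ ℚ.* (a ℚ.* b)
      ≡⟨ cong (∣ r ℚ.- s ∣ ℚ.*_) (ℚP.0≤p⇒∣p∣≡p (ℚP.<⇒≤ (*-pos 0<a 0<b))) ⟨
    ∣ r ℚ.- s ∣ ℚ.* ∣ a ℚ.* b ∣
      ≡⟨ ℚP.∣p*q∣≡∣p∣*∣q∣ (r ℚ.- s) (a ℚ.* b) ⟨
    ∣ (r ℚ.- s) ℚ.* (a ℚ.* b) ∣
      ≡⟨ cong ∣_∣ (id₄ r s a b) ⟩
    ∣ (r ℚ.* a) ℚ.* b ℚ.- (s ℚ.* b) ℚ.* a ∣
      ≡⟨ cong ∣_∣ (cong₂ (λ u v → u ℚ.* b ℚ.- v ℚ.* a) ra sb) ⟩
    ∣ 1ℚ ℚ.* b ℚ.- 1ℚ ℚ.* a ∣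
      ≡⟨ cong ∣_∣ (cong₂ ℚ._-_ (ℚP.*-identityˡ b) (ℚP.*-identityˡ a)) ⟩
    ∣ b ℚ.- a ∣
      ≤⟨ h ⟩
    ε ℚ.* (η ℚ.* η) ∎)
    where
    open ℚP.≤-Reasoning
    0<a = ℚP.<-≤-trans η>0 η≤a
    0<b = ℚP.<-≤-trans η>0 η≤b

  scaled : ∀ {ε B} → 0ℚ ℚ.< ε → 0ℚ ℚ.< B → ∃[ ε′ ] (0ℚ ℚ.< ε′ × B ℚ.* ε′ ≡ ε)
  scaled {ε} {B} ε>0 B>0 = 1/B ℚ.* ε
    , *-pos (ℚP.positive⁻¹ 1/B {{ℚP.1/pos⇒pos B}}) ε>0
    , trans (sym (ℚP.*-assoc B 1/B ε))
            (trans (cong (ℚ._* ε) (ℚP.*-inverseʳ B)) (ℚP.*-identityˡ ε))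
    where
    instance
      posB = ℚ.positive B>0
      nzB  = ℚP.pos⇒nonZero B
    1/B = ℚ.1/ B

record ℝ : Set where
  constructor mkℝ
  field
    seq    : ℕ → ℚ
    cauchy : ∀ {ε} → 0ℚ ℚ.< ε →
             ∃[ N ] (∀ {m n} → N ℕ.≤ m → N ℕ.≤ n → ∣ seq m ℚ.- seq n ∣ ℚ.≤ ε)

open ℝ public

infix 4 _<_ _≤_

_<_ : ℝ → ℝ → Set
x < y = ∃[ ε ] (0ℚ ℚ.< ε × ∃[ N ] (∀ {n} → N ℕ.≤ n → seq x n ℚ.+ ε ℚ.≤ seq y n))

_≤_ : ℝ → ℝ → Set
x ≤ y = ∀ {ε} → 0ℚ ℚ.< ε → ∃[ N ] (∀ {n} → N ℕ.≤ n → seq x n ℚ.≤ seq y n ℚ.+ ε)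

fromℚ : ℚ → ℝ
fromℚ q = mkℝ (λ _ → q)
  (λ ε>0 → 0 , λ _ _ → subst (ℚ._≤ _) (sym (cong ∣_∣ (ℚP.+-inverseʳ q))) (ℚP.<⇒≤ ε>0))

fromℕ : ℕ → ℝ
fromℕ n = fromℚ (fromℤ (+ n))

0ℝ 1ℝ : ℝ
0ℝ = fromℕ 0
1ℝ = fromℕ 1

infix  8 -_
infixl 7 _*_ _/_[_]
infixl 6 _+_ _-_

_+_ : ℝ → ℝ → ℝ
x + y = mkℝ (λ n → seq x n ℚ.+ seq y n) λ {ε} ε>0 →
  let (M , f) = cauchy x (half-pos ε>0)
      (N , g) = cauchy y (half-pos ε>0)
  in M ℕ.⊔ N , λ {m} {n} h k →
    subst (∣ (seq x m ℚ.+ seq y m) ℚ.- (seq x n ℚ.+ seq y n) ∣ ℚ.≤_) (half+half ε)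
      (∣+∣-bound (seq x m) (seq y m) (seq x n) (seq y n)
        (f (ℕP.m⊔n≤o⇒m≤o M N h) (ℕP.m⊔n≤o⇒m≤o M N k))
        (g (ℕP.m⊔n≤o⇒n≤o M N h) (ℕP.m⊔n≤o⇒n≤o M N k)))

-_ : ℝ → ℝ
- x = mkℝ (λ n → ℚ.- seq x n) λ {ε} ε>0 →
  let (N , f) = cauchy x ε>0
  in N , λ {m} {n} h k → subst (ℚ._≤ ε)
    (trans (sym (ℚP.∣-p∣≡∣p∣ (seq x m ℚ.- seq x n)))
           (cong ∣_∣ (ℚP.neg-distrib-+ (seq x m) (ℚ.- seq x n))))
    (f h k)

_-_ : ℝ → ℝ → ℝ
x - y = x + - y

private
  bounded : ∀ x → ∃[ B ] (0ℚ ℚ.< B × ∃[ N ] (∀ {n} → N ℕ.≤ n → ∣ seq x n ∣ ℚ.≤ B))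
  bounded x =
    let (N , f) = cauchy x (ℚP.positive⁻¹ 1ℚ)
    in ∣ seq x N ∣ ℚ.+ 1ℚ
     , ℚP.+-mono-≤-< {0ℚ} (ℚP.0≤∣p∣ (seq x N)) (ℚP.positive⁻¹ 1ℚ)
     , N , λ {n} h → ∣∣-bound (seq x n) (seq x N) (f h ℕP.≤-refl)

_*_ : ℝ → ℝ → ℝ
x * y = mkℝ (λ n → seq x n ℚ.* seq y n) λ {ε} ε>0 →
  let (B , B>0 , N₁ , bx) = bounded x
      (C , C>0 , N₂ , by) = bounded y
      (ε₁ , ε₁>0 , Bε₁) = scaled (half-pos ε>0) B>0
      (ε₂ , ε₂>0 , Cε₂) = scaled (half-pos ε>0) C>0
      (N₃ , f) = cauchy x ε₂>0
      (N₄ , g) = cauchy y ε₁>0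
  in (N₁ ℕ.⊔ N₂) ℕ.⊔ (N₃ ℕ.⊔ N₄) , λ {m} {n} h k →
    let h₁₂ = ℕP.m⊔n≤o⇒m≤o (N₁ ℕ.⊔ N₂) (N₃ ℕ.⊔ N₄) h
        h₃₄ = ℕP.m⊔n≤o⇒n≤o (N₁ ℕ.⊔ N₂) (N₃ ℕ.⊔ N₄) h
        k₁₂ = ℕP.m⊔n≤o⇒m≤o (N₁ ℕ.⊔ N₂) (N₃ ℕ.⊔ N₄) k
        k₃₄ = ℕP.m⊔n≤o⇒n≤o (N₁ ℕ.⊔ N₂) (N₃ ℕ.⊔ N₄) k
    in subst (∣ seq x m ℚ.* seq y m ℚ.- seq x n ℚ.* seq y n ∣ ℚ.≤_)
         (trans (cong₂ ℚ._+_ Bε₁ Cε₂) (half+half ε))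
         (∣*∣-bound (seq x m) (seq y m) (seq x n) (seq y n)
           (bx (ℕP.m⊔n≤o⇒m≤o N₁ N₂ h₁₂)) (by (ℕP.m⊔n≤o⇒n≤o N₁ N₂ k₁₂))
           (f (ℕP.m⊔n≤o⇒m≤o N₃ N₄ h₃₄) (ℕP.m⊔n≤o⇒m≤o N₃ N₄ k₃₄))
           (g (ℕP.m⊔n≤o⇒n≤o N₃ N₄ h₃₄) (ℕP.m⊔n≤o⇒n≤o N₃ N₄ k₃₄)))

-- The value at 0 is irrelevant: the sequence of a positive real is
-- eventually bounded away from 0.
recipℚ : ℚ → ℚ
recipℚ q with q ℚP.≟ 0ℚ
... | yes _  = 0ℚ
... | no q≢0 = (ℚ.1/ q) {{ℚ.≢-nonZero q≢0}}

private
  recipℚ-inverse : ∀ q → 0ℚ ℚ.< q → recipℚ q ℚ.* q ≡ 1ℚ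
  recipℚ-inverse q q>0 with q ℚP.≟ 0ℚ
  ... | yes q≡0 = ⊥-elim (ℚP.<⇒≢ q>0 (sym q≡0))
  ... | no q≢0  = ℚP.*-inverseˡ q {{ℚ.≢-nonZero q≢0}}

recip : (x : ℝ) → 0ℝ < x → ℝ
recip x (η , η>0 , M , 0+η≤x) = mkℝ (λ n → recipℚ (seq x n)) λ ε>0 →
  let (N , f) = cauchy x (*-pos ε>0 (*-pos η>0 η>0))
  in M ℕ.⊔ N , λ {m} {n} h k →
    let hη = η≤x (ℕP.m⊔n≤o⇒m≤o M N h)
        kη = η≤x (ℕP.m⊔n≤o⇒m≤o M N k)
    in ∣recip∣-bound (seq x m) (seq x n) (recipℚ (seq x m)) (recipℚ (seq x n))
         (recipℚ-inverse (seq x m) (ℚP.<-≤-trans η>0 hη))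
         (recipℚ-inverse (seq x n) (ℚP.<-≤-trans η>0 kη))
         η>0 hη kη
         (f (ℕP.m⊔n≤o⇒n≤o M N k) (ℕP.m⊔n≤o⇒n≤o M N h))
  where
  η≤x : ∀ {n} → M ℕ.≤ n → η ℚ.≤ seq x n
  η≤x {n} h = subst (ℚ._≤ seq x n) (ℚP.+-identityˡ η) (0+η≤x h)

_/_[_] : (x y : ℝ) → 0ℝ < y → ℝ
x / y [ y>0 ] = x * recip y y>0

infixr 8 _^ℚ_

_^ℚ_ : ℚ → ℕ → ℚ
q ^ℚ zero  = 1ℚ
q ^ℚ suc k = q ℚ.* q ^ℚ k

-- The greatest j ≤ b satisfying P, or 0 if there is none.
greatest : ∀ {P : ℕ → Set} → Decidable P → ℕ → ℕ
greatest P? zero    = 0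
greatest P? (suc b) with P? (suc b)
... | yes _ = suc b
... | no  _ = greatest P? b

-- The k-th root of q (of 0, when q < 0), rounded down to a multiple of
-- 1 / (i + 1); the bound loses nothing, since for k ≥ 1 that root is
-- smaller than |numerator q| + 1.
rootIndex : (k : ℕ) → ℚ → ℕ → ℕ
rootIndex k q i =
  greatest (λ j → (+ j ℚ./ suc i) ^ℚ k ℚP.≤? q) (suc i ℕ.* suc ℤ.∣ ℚ.↥ q ∣)

-- Opaque so that the type checker does not normalise the fraction.
opaque
  rootℚ : (k : ℕ) → ℚ → ℕ → ℚ
  rootℚ k q i = + rootIndex k q i ℚ./ suc i

private
  0≤j/i : ∀ j i → 0ℚ ℚ.≤ + j ℚ./ suc i
  0≤j/i j i = ℚP.nonNegative⁻¹ _ {{ℚP.normalize-nonNeg j (suc i)}}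

  toℚᵘ-/ : ∀ j i → ℚ.toℚᵘ (+ j ℚ./ suc i) ℚᵘ.≃ (+ j ℚᵘ./ suc i)
  toℚᵘ-/ j i = ℚP.toℚᵘ-fromℚᵘ (+ j ℚᵘ./ suc i)

  suc-/ : ∀ j i → + suc j ℚ./ suc i ≡ + j ℚ./ suc i ℚ.+ + 1 ℚ./ suc i
  suc-/ j i = ℚP.toℚᵘ-injective (begin
    ℚ.toℚᵘ (+ suc j ℚ./ suc i)
      ≈⟨ toℚᵘ-/ (suc j) i ⟩
    + suc j ℚᵘ./ suc i
      ≈⟨ ℚᵘ.*≡* eq ⟩
    + j ℚᵘ./ suc i ℚᵘ.+ + 1 ℚᵘ./ suc i
      ≈⟨ ℚᵘP.+-cong (toℚᵘ-/ j i) (toℚᵘ-/ 1 i) ⟨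
    ℚ.toℚᵘ (+ j ℚ./ suc i) ℚᵘ.+ ℚ.toℚᵘ (+ 1 ℚ./ suc i)
      ≈⟨ ℚP.toℚᵘ-homo-+ (+ j ℚ./ suc i) (+ 1 ℚ./ suc i) ⟨
    ℚ.toℚᵘ (+ j ℚ./ suc i ℚ.+ + 1 ℚ./ suc i) ∎)
    where
    open ℚᵘP.≃-Reasoning
    open ℤS.+-*-Solver using () renaming (solve to solveℤ; con to conℤ; _:=_ to _≔_; _:+_ to _⊕_; _:*_ to _⊗_)
    eq : + suc j ℤ.* (+ suc i ℤ.* + suc i) ≡ (+ j ℤ.* + suc i ℤ.+ + 1 ℤ.* + suc i) ℤ.* + suc i
    eq = solveℤ 2 (λ J D → (conℤ (+ 1) ⊕ J) ⊗ (D ⊗ D) ≔ (J ⊗ D ⊕ conℤ (+ 1) ⊗ D) ⊗ D) refl (+ j) (+ suc i)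

  1/≤ : ∀ {i N} → N ℕ.≤ i → + 1 ℚ./ suc i ℚ.≤ + 1 ℚ./ suc N
  1/≤ {i} {N} h = ℚP.toℚᵘ-cancel-≤ (begin
    ℚ.toℚᵘ (+ 1 ℚ./ suc i)   ≃⟨ toℚᵘ-/ 1 i ⟩
    + 1 ℚᵘ./ suc i           ≤⟨ ℚᵘ.*≤* (ℤ.+≤+ (ℕP.*-monoʳ-≤ 1 (ℕ.s≤s h))) ⟩
    + 1 ℚᵘ./ suc N           ≃⟨ toℚᵘ-/ 1 N ⟨
    ℚ.toℚᵘ (+ 1 ℚ./ suc N)   ∎)
    where open ℚᵘP.≤-Reasoning

  1/<ε : ∀ {ε} → 0ℚ ℚ.< ε → ∃[ N ] (+ 1 ℚ./ suc N ℚ.≤ ε)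
  1/<ε {ε@(ℚ.mkℚ ℤ.+[1+ a ] d _)} ε>0 = d , ℚP.toℚᵘ-cancel-≤ (begin
    ℚ.toℚᵘ (+ 1 ℚ./ suc d)   ≃⟨ toℚᵘ-/ 1 d ⟩
    + 1 ℚᵘ./ suc d           ≤⟨ ℚᵘ.*≤* (ℤ.+≤+ (ℕP.*-monoˡ-≤ (suc d) (ℕ.s≤s (ℕ.z≤n {a})))) ⟩
    ℚ.toℚᵘ ε                 ∎)
    where open ℚᵘP.≤-Reasoning
  1/<ε {ℚ.mkℚ (+ 0) d _} (ℚ.*<* (ℤ.+<+ ()))
  1/<ε {ℚ.mkℚ ℤ.-[1+ a ] d _} (ℚ.*<* ())

  q<bound : ∀ q i → q ℚ.< + (suc i ℕ.* suc ℤ.∣ ℚ.↥ q ∣) ℚ./ suc i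
  q<bound q@(ℚ.mkℚ n d _) i = ℚP.toℚᵘ-cancel-< (begin-strict
    ℚ.toℚᵘ q                                          <⟨ ℚᵘ.*<* (lt n) ⟩
    + (suc i ℕ.* suc ℤ.∣ n ∣) ℚᵘ./ suc i              ≃⟨ toℚᵘ-/ (suc i ℕ.* suc ℤ.∣ n ∣) i ⟨
    ℚ.toℚᵘ (+ (suc i ℕ.* suc ℤ.∣ n ∣) ℚ./ suc i)      ∎)
    where
    open ℚᵘP.≤-Reasoning
    lt : ∀ n → n ℤ.* + suc i ℤ.< + (suc i ℕ.* suc ℤ.∣ n ∣) ℤ.* + suc d
    lt (+ a) = subst (ℤ._< + (suc i ℕ.* suc a) ℤ.* + suc d) (ℤP.pos-* a (suc i)) (ℤ.+<+ (ℕP.<-≤-trans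
      (ℕP.*-monoˡ-< (suc i) (ℕP.n<1+n a))
      (subst (ℕ._≤ suc i ℕ.* suc a ℕ.* suc d)
             (trans (ℕP.*-identityʳ _) (ℕP.*-comm (suc i) (suc a)))
             (ℕP.*-monoʳ-≤ (suc i ℕ.* suc a) (ℕ.s≤s ℕ.z≤n)))))
    lt ℤ.-[1+ a ] = ℤ.-<+

  ^ℚ-nonNeg : ∀ {p} k → 0ℚ ℚ.≤ p → 0ℚ ℚ.≤ p ^ℚ k
  ^ℚ-nonNeg zero    h = ℚP.<⇒≤ (ℚP.positive⁻¹ 1ℚ)
  ^ℚ-nonNeg (suc k) h = *-nonNeg h (^ℚ-nonNeg k h)

  ^ℚ-pos : ∀ {p} k → 0ℚ ℚ.< p → 0ℚ ℚ.< p ^ℚ k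
  ^ℚ-pos zero    h = ℚP.positive⁻¹ 1ℚ
  ^ℚ-pos (suc k) h = *-pos h (^ℚ-pos k h)

  ^ℚ-mono : ∀ {p q} k → 0ℚ ℚ.≤ p → p ℚ.≤ q → p ^ℚ k ℚ.≤ q ^ℚ k
  ^ℚ-mono zero    h l = ℚP.≤-refl
  ^ℚ-mono (suc k) h l =
    *-mono-≤-nonNeg h (^ℚ-nonNeg k (ℚP.≤-trans h l)) l (^ℚ-mono k h l)

  +-nonNeg : ∀ {p q} → 0ℚ ℚ.≤ p → 0ℚ ℚ.≤ q → 0ℚ ℚ.≤ p ℚ.+ q
  +-nonNeg {p} {q} h l = subst (ℚ._≤ p ℚ.+ q) (ℚP.+-identityˡ 0ℚ) (ℚP.+-mono-≤ h l)

  ≤+ : ∀ {p q} → 0ℚ ℚ.≤ q → p ℚ.≤ p ℚ.+ q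
  ≤+ {p} {q} h = subst (ℚ._≤ p ℚ.+ q) (ℚP.+-identityʳ p) (ℚP.+-monoʳ-≤ p h)

  id₅ : ∀ s e S E → (s ℚ.* S ℚ.+ e ℚ.* E) ℚ.+ (s ℚ.* E ℚ.+ e ℚ.* S) ≡ (s ℚ.+ e) ℚ.* (S ℚ.+ E)
  id₅ = solve 4 (λ s e S E → (s :* S :+ e :* E) :+ (s :* E :+ e :* S) := (s :+ e) :* (S :+ E)) refl

  ^ℚ-superadditive : ∀ k {s e} → 0ℚ ℚ.≤ s → 0ℚ ℚ.≤ e →
                     s ^ℚ suc k ℚ.+ e ^ℚ suc k ℚ.≤ (s ℚ.+ e) ^ℚ suc k
  ^ℚ-superadditive zero    {s} {e} hs he = ℚP.≤-reflexive (sym (ℚP.*-distribʳ-+ 1ℚ s e))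
  ^ℚ-superadditive (suc k) {s} {e} hs he = begin
    s ℚ.* S ℚ.+ e ℚ.* E
      ≤⟨ ≤+ (+-nonNeg (*-nonNeg hs (^ℚ-nonNeg (suc k) he)) (*-nonNeg he (^ℚ-nonNeg (suc k) hs))) ⟩
    (s ℚ.* S ℚ.+ e ℚ.* E) ℚ.+ (s ℚ.* E ℚ.+ e ℚ.* S)
      ≡⟨ id₅ s e S E ⟩
    (s ℚ.+ e) ℚ.* (S ℚ.+ E)
      ≤⟨ ℚP.*-monoˡ-≤-nonNeg (s ℚ.+ e) {{ℚ.nonNegative (+-nonNeg hs he)}} (^ℚ-superadditive k hs he) ⟩
    (s ℚ.+ e) ℚ.* (s ℚ.+ e) ^ℚ suc k ∎
    where
    open ℚP.≤-Reasoning
    S = s ^ℚ suc k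
    E = e ^ℚ suc k

  greatest-yes : ∀ {P : ℕ → Set} (P? : Decidable P) b →
                 greatest P? b ≡ 0 ⊎ P (greatest P? b)
  greatest-yes P? zero    = inj₁ refl
  greatest-yes P? (suc b) with P? (suc b)
  ... | yes p = inj₂ p
  ... | no  _ = greatest-yes P? b

  greatest-no : ∀ {P : ℕ → Set} (P? : Decidable P) b →
                ¬ P (suc b) → ¬ P (suc (greatest P? b))
  greatest-no P? zero    ¬p = ¬p
  greatest-no P? (suc b) ¬p with P? (suc b)
  ... | yes _  = ¬p
  ... | no ¬p′ = greatest-no P? b ¬p′

  1≤M/1 : ∀ M i → 1ℚ ℚ.≤ + (suc i ℕ.* suc M) ℚ./ suc i
  1≤M/1 M i = ℚP.toℚᵘ-cancel-≤ (begin
    ℚ.toℚᵘ 1ℚ                                  ≤⟨ ℚᵘ.*≤* (ℤ.+≤+ le) ⟩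
    + (suc i ℕ.* suc M) ℚᵘ./ suc i             ≃⟨ toℚᵘ-/ (suc i ℕ.* suc M) i ⟨
    ℚ.toℚᵘ (+ (suc i ℕ.* suc M) ℚ./ suc i)     ∎)
    where
    open ℚᵘP.≤-Reasoning
    le : 1 ℕ.* suc i ℕ.≤ suc i ℕ.* suc M ℕ.* 1
    le = subst₂ ℕ._≤_ (ℕP.*-comm (suc i) 1) (sym (ℕP.*-identityʳ (suc i ℕ.* suc M)))
           (ℕP.*-monoʳ-≤ (suc i) (ℕ.s≤s ℕ.z≤n))

  ≤-pow : ∀ k {p} → 1ℚ ℚ.≤ p → p ℚ.≤ p ^ℚ suc k
  ≤-pow zero    {p} h = ℚP.≤-reflexive (sym (ℚP.*-identityʳ p))
  ≤-pow (suc k) {p} h = ℚP.≤-trans (≤-pow k h)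
    (subst (ℚ._≤ p ℚ.* p ^ℚ suc k) (ℚP.*-identityˡ (p ^ℚ suc k))
      (ℚP.*-monoʳ-≤-nonNeg (p ^ℚ suc k) {{ℚ.nonNegative (^ℚ-nonNeg (suc k)
        (ℚP.≤-trans (ℚP.<⇒≤ (ℚP.positive⁻¹ 1ℚ)) h))}} h))

  bound-pow : ∀ k b i {q} → q ℚ.< + b ℚ./ suc i → 1ℚ ℚ.≤ + b ℚ./ suc i →
              q ℚ.< (+ suc b ℚ./ suc i) ^ℚ suc k
  bound-pow k b i {q} q<b 1≤b = begin-strict
    q                              <⟨ q<b ⟩
    + b ℚ./ suc i                  ≤⟨ b≤ ⟩
    + suc b ℚ./ suc i              ≤⟨ ≤-pow k (ℚP.≤-trans 1≤b b≤) ⟩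
    (+ suc b ℚ./ suc i) ^ℚ suc k   ∎
    where
    open ℚP.≤-Reasoning
    b≤ = subst (+ b ℚ./ suc i ℚ.≤_) (sym (suc-/ b i)) (≤+ (0≤j/i 1 i))

  rootIndex-yes : ∀ k q i → rootIndex k q i ≡ 0 ⊎ (+ rootIndex k q i ℚ./ suc i) ^ℚ k ℚ.≤ q
  rootIndex-yes k q i = greatest-yes (λ j → (+ j ℚ./ suc i) ^ℚ k ℚP.≤? q) _

  rootIndex-no : ∀ k q i → q ℚ.< (+ suc (rootIndex (suc k) q i) ℚ./ suc i) ^ℚ suc k
  rootIndex-no k q i = ℚP.≰⇒> (greatest-no (λ j → (+ j ℚ./ suc i) ^ℚ suc k ℚP.≤? q) b
    (λ l → ℚP.<-irrefl refl (ℚP.<-≤-trans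
      (bound-pow k b i (q<bound q i) (1≤M/1 ℤ.∣ ℚ.↥ q ∣ i)) l)))
    where b = suc i ℕ.* suc ℤ.∣ ℚ.↥ q ∣

  -- |p^{1/k} - q^{1/k}| ≤ |p - q|^{1/k}, up to the rounding h of q^{1/k}.
  Hölder : ∀ k {p q a c h ε} → 0ℚ ℚ.≤ c → 0ℚ ℚ.≤ h → 0ℚ ℚ.≤ ε →
           a ≡ 0ℚ ⊎ a ^ℚ suc k ℚ.≤ p → q ℚ.< (c ℚ.+ h) ^ℚ suc k →
           p ℚ.- q ℚ.≤ ε ^ℚ suc k → a ℚ.≤ c ℚ.+ (h ℚ.+ ε)
  Hölder k {p} {q} {a} {c} {h} {ε} 0≤c 0≤h 0≤ε a-lower c-upper p-q≤ =
    subst (a ℚ.≤_) (ℚP.+-assoc c h ε) (goal a-lower)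
    where
    s = c ℚ.+ h
    0≤s = +-nonNeg 0≤c 0≤h
    0≤s+ε = +-nonNeg 0≤s 0≤ε
    goal : a ≡ 0ℚ ⊎ a ^ℚ suc k ℚ.≤ p → a ℚ.≤ s ℚ.+ ε
    goal lower with a ℚP.≤? s ℚ.+ ε | lower
    ... | yes l | _       = l
    ... | no ¬l | inj₁ eq = subst (ℚ._≤ s ℚ.+ ε) (sym eq) 0≤s+ε
    ... | no ¬l | inj₂ l  = ⊥-elim (ℚP.<-irrefl refl (begin-strict
        p                              ≤⟨ sub-≤ p-q≤ ⟩
        q ℚ.+ ε ^ℚ suc k               <⟨ ℚP.+-monoˡ-< (ε ^ℚ suc k) c-upper ⟩
        s ^ℚ suc k ℚ.+ ε ^ℚ suc k      ≤⟨ ^ℚ-superadditive k 0≤s 0≤ε ⟩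
        (s ℚ.+ ε) ^ℚ suc k             ≤⟨ ^ℚ-mono (suc k) 0≤s+ε (ℚP.<⇒≤ (ℚP.≰⇒> ¬l)) ⟩
        a ^ℚ suc k                     ≤⟨ l ⟩
        p                              ∎))
      where open ℚP.≤-Reasoning

  0/ : ∀ {j} i → j ≡ 0 → + j ℚ./ suc i ≡ 0ℚ
  0/ i refl = ℚP.0/n≡0 (suc i)

  rounded : ∀ k j i {q} → q ℚ.< (+ suc j ℚ./ suc i) ^ℚ k →
            q ℚ.< (+ j ℚ./ suc i ℚ.+ + 1 ℚ./ suc i) ^ℚ k
  rounded k j i {q} = subst (λ r → q ℚ.< r ^ℚ k) (suc-/ j i)

opaque
  unfolding rootℚ

  rootℚ-nonNeg : ∀ k q i → 0ℚ ℚ.≤ rootℚ k q i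
  rootℚ-nonNeg k q i = 0≤j/i (rootIndex k q i) i

  rootℚ-lower : ∀ k q i → rootℚ k q i ≡ 0ℚ ⊎ rootℚ k q i ^ℚ k ℚ.≤ q
  rootℚ-lower k q i = map₁ (0/ i) (rootIndex-yes k q i)

  rootℚ-upper : ∀ k .{{_ : NonZero k}} q i → q ℚ.< (rootℚ k q i ℚ.+ + 1 ℚ./ suc i) ^ℚ k
  rootℚ-upper k@(suc k-1) q i = rounded k (rootIndex k q i) i (rootIndex-no k-1 q i)

private
  close-abs : ∀ {a b ε} → a ℚ.≤ b ℚ.+ ε → b ℚ.≤ a ℚ.+ ε → ∣ a ℚ.- b ∣ ℚ.≤ ε
  close-abs {a} {b} {ε} h k = ∣p∣≤ (≤-sub h) (subst (ℚ._≤ ε) (id₆ b a) (≤-sub k))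
    where
    id₆ : ∀ b a → b ℚ.- a ≡ ℚ.- (a ℚ.- b)
    id₆ = solve 2 (λ b a → b :+ :- a := :- (a :+ :- b)) refl

  half-close : ∀ {a b h ε} → a ℚ.≤ b ℚ.+ (h ℚ.+ ε ℚ.* ½) → h ℚ.≤ ε ℚ.* ½ → a ℚ.≤ b ℚ.+ ε
  half-close {a} {b} {h} {ε} l h≤ = ℚP.≤-trans l (ℚP.+-monoʳ-≤ b
    (subst (h ℚ.+ ε ℚ.* ½ ℚ.≤_) (half+half ε) (ℚP.+-monoˡ-≤ (ε ℚ.* ½) h≤)))

-- The k-th root of x (of 0, when x < 0).
root : (k : ℕ) .{{_ : NonZero k}} → ℝ → ℝ
root k@(suc k-1) x = mkℝ r λ {ε} ε>0 →
  let (M , f) = cauchy x (^ℚ-pos k (half-pos ε>0))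
      (N , 1/N≤) = 1/<ε (half-pos ε>0)
  in M ℕ.⊔ N , λ {m} {n} h l →
    close-abs
      (close ε>0 M f N 1/N≤ {m} {n} h l)
      (close ε>0 M f N 1/N≤ {n} {m} l h)
  where
  r : ℕ → ℚ
  r n = rootℚ k (seq x n) n
  close : ∀ {ε} → 0ℚ ℚ.< ε →
          ∀ M → (∀ {m n} → M ℕ.≤ m → M ℕ.≤ n → ∣ seq x m ℚ.- seq x n ∣ ℚ.≤ (ε ℚ.* ½) ^ℚ k) →
          ∀ N → + 1 ℚ./ suc N ℚ.≤ ε ℚ.* ½ →
          ∀ {m n} → M ℕ.⊔ N ℕ.≤ m → M ℕ.⊔ N ℕ.≤ n → r m ℚ.≤ r n ℚ.+ ε
  close {ε} ε>0 M f N 1/N≤ {m} {n} h l = half-close {r m} {r n} {+ 1 ℚ./ suc n} {ε}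
    (Hölder k-1 {seq x m} {seq x n} {r m} {r n} {+ 1 ℚ./ suc n} {ε ℚ.* ½}
      (rootℚ-nonNeg k (seq x n) n) (0≤j/i 1 n) (ℚP.<⇒≤ (half-pos ε>0))
      (rootℚ-lower k (seq x m) m) (rootℚ-upper k (seq x n) n)
      (ℚP.≤-trans (p≤∣p∣ (seq x m ℚ.- seq x n))
        (f (ℕP.m⊔n≤o⇒m≤o M N h) (ℕP.m⊔n≤o⇒m≤o M N l))))
    (ℚP.≤-trans (1/≤ (ℕP.m⊔n≤o⇒n≤o M N l)) 1/N≤)

infixl 8 _^1+1/_

_^1+1/_ : ℝ → (k : ℕ) .{{_ : NonZero k}} → ℝ
x ^1+1/ k = x * root k x

c>3⇒c>0 : ∀ {c} → fromℕ 3 < c → 0ℝ < c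
c>3⇒c>0 (ε , ε>0 , N , h) = ε , ε>0 , N , λ l →
  ℚP.≤-trans (ℚP.+-monoˡ-≤ ε (ℚP.<⇒≤ (ℚP.positive⁻¹ (fromℤ (+ 3))))) (h l)

c>3⇒c-1>0 : ∀ {c} → fromℕ 3 < c → 0ℝ < c - 1ℝ
c>3⇒c-1>0 (ε , ε>0 , N , h) = ε , ε>0 , N , λ l →
  ℚP.≤-trans (ℚP.+-monoˡ-≤ ε (ℚP.<⇒≤ (ℚP.positive⁻¹ 2ℚ)))
    (ℚP.≤-trans (ℚP.≤-reflexive (2+ε ε)) (ℚP.+-monoˡ-≤ (ℚ.- 1ℚ) (h l)))
  where
  2ℚ = fromℤ (+ 2)
  3ℚ = fromℤ (+ 3)
  2+ε : ∀ ε → 2ℚ ℚ.+ ε ≡ 3ℚ ℚ.+ ε ℚ.- 1ℚ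
  2+ε = solve 1 (λ ε → con 2ℚ :+ ε := con 3ℚ :+ ε :+ :- con 1ℚ) refl

δ>0⇒1+δ>0 : ∀ {δ} → 0ℝ < δ → 0ℝ < 1ℝ + δ
δ>0⇒1+δ>0 {δ} (ε , ε>0 , N , h) = ε , ε>0 , N , λ {n} l →
  ℚP.≤-trans (h l) (ℚP.≤-trans (ℚP.≤-reflexive (sym (ℚP.+-identityˡ (seq δ n))))
    (ℚP.+-monoˡ-≤ (seq δ n) (ℚP.<⇒≤ (ℚP.positive⁻¹ 1ℚ))))

record Graph (n : ℕ) : Set where
  field
    adj        : Fin n → Fin n → Bool
    adj-sym    : ∀ u v → adj u v ≡ adj v u
    adj-irrefl : ∀ u → adj u u ≡ false

  Adj : Fin n → Fin n → Set
  Adj u v = T (adj u v)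

  edges : List (Fin n × Fin n)
  edges = filterᵇ (λ (u , v) → ⌊ u <F? v ⌋ ∧ adj u v) (cartesianProduct (allFin n) (allFin n))

  #edges : ℕ
  #edges = length edges

open Graph public

infix 4 _⊆ᴳ_

_⊆ᴳ_ : ∀ {n} → Graph n → Graph n → Set
H ⊆ᴳ G = ∀ {u v} → Adj H u v → Adj G u v

infixr 5 _∷_

data Walk {n} (G : Graph n) : Fin n → Fin n → ℕ → Set where
  []  : ∀ {u} → Walk G u u 0
  _∷_ : ∀ {u v w ℓ} → Adj G u v → Walk G v w ℓ → Walk G u w (suc ℓ)

-- d_G(u,v) = d; no d satisfies this when d_G(u,v) = ∞.
IsDistance : ∀ {n} → Graph n → Fin n → Fin n → ℕ → Set
IsDistance G u v d = Walk G u v d × (∀ {ℓ} → Walk G u v ℓ → d ℕ.≤ ℓ)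

-- d_H(u,v) ≤ α · d_G(u,v) holds trivially when d_G(u,v) = ∞.
IsSpanner : ∀ {n} → ℕ → Graph n → Graph n → Set
IsSpanner α H G =
  H ⊆ᴳ G ×
  (∀ u v {d} → IsDistance G u v d → ∃[ d′ ] (IsDistance H u v d′ × d′ ℕ.≤ α ℕ.* d))

-- A value computed from a uniformly random seed in a finite set. In a
-- function A → Randomized B the seed set may depend on the input.
record Randomized (A : Set) : Set where
  field
    #seeds             : ℕ
    {{#seeds-nonZero}} : NonZero #seeds
    run                : Fin #seeds → A

open Randomized public

-- The event E need not be decidable, so its probability is bounded below
-- by that of a decidable event S contained in it.
Pr[_∈_]≥_ : {A : Set} → Randomized A → (A → Set) → ℝ → Set
Pr[ X ∈ E ]≥ p = Σ[ S ∈ Subset (#seeds X) ]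
  (∀ {s} → s ∈ S → E (run X s)) × p ≤ fromℚ ((+ card S ℚ./ #seeds X) {{#seeds-nonZero X}})

{-# OPTIONS --safe #-}
-- The spanner is deterministic (one seed, success probability 1), by ball
-- growing: around a remaining vertex v, grow a ball B(0) ⊆ B(1) ⊆ … in the
-- remaining vertices until |B(i+1)| ≤ n^{1/k} |B(i)|, which happens for some
-- i < k because |B(k)| ≤ n.  Keep a BFS tree of B(i+1), delete B(i), repeat.
-- A tree is paid for by the n^{1/k} |B(i)| of its deleted vertices, so there
-- are at most n^{1+1/k} edges.  An edge with an end in B(i) has both ends in
-- the tree, at depths at most i and i + 1, hence stretch 2i + 1 ≤ 2k − 1.
-- Finally A = (cn)^{1+1/k} / (c − 1) is at least n^{1+1/k} ≥ n − 1, and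
-- (1 + δ) A − δ (n − 1) = A + δ (A − (n − 1)) ≥ A.
module Submission where

open import Defs
open import Data.Bool.Base using (Bool; T; _∧_; _∨_)
open import Data.Bool.Properties using (∨-comm; T-∧; T-∨; T?)
open import Data.Empty using (⊥-elim)
open import Data.Fin.Base using (Fin)
import Data.Fin.Properties as FinP
open import Data.Fin.Subset using (⊤)
open import Data.Integer.Base as ℤ using (+_)
import Data.Integer.Properties as ℤP
open import Data.List.Base using (List; []; _∷_; _++_; length; map; cartesianProduct; allFin)
open import Data.List.Membership.DecPropositional using (_∈?_)
open import Data.List.Membership.Propositional using (_∈_; find; lose)
open import Data.List.Membership.Propositional.Properties
  using (∈-∃++; ∈-++⁻; ∈-++⁺ˡ; ∈-++⁺ʳ; ∈-map⁺; ∈-filter⁻; ∈-allFin)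
import Data.List.Properties as ListP
open import Data.List.Relation.Binary.Subset.Propositional using (_⊆_)
import Data.List.Relation.Unary.All as All
open import Data.List.Relation.Unary.AllPairs using ([]; _∷_)
open import Data.List.Relation.Unary.Any as Any using (here; there)
open import Data.List.Relation.Unary.Unique.Propositional using (Unique)
import Data.List.Relation.Unary.Unique.Propositional.Properties as UniqueP
open import Data.Nat.Base as ℕ using (zero; suc; z≤n; s≤s)
open import Data.Nat.Base using (ℕ; NonZero; _∸_) renaming (_*_ to _*ℕ_)
import Data.Nat.Properties as ℕP
open import Data.Product.Base as Product using (Σ-syntax; ∃-syntax; _×_; _,_; proj₁)
import Data.Product.Properties as ProductP
open import Data.Rational.Base as ℚ using (ℚ; 0ℚ; 1ℚ)
open import Data.Rational.Literals using (fromℤ)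
import Data.Rational.Properties as ℚP
open import Data.Rational.Solver using (module +-*-Solver)
import Data.Rational.Unnormalised.Base as ℚᵘ
import Data.Rational.Unnormalised.Properties as ℚᵘP
open import Data.Sum.Base as Sum using (_⊎_; inj₁; inj₂; [_,_]′)
open import Function.Base using (_∘_; id)
open import Function.Bundles using (Equivalence)
open import Relation.Binary.Definitions using (DecidableEquality)
open import Relation.Binary.PropositionalEquality
  using (_≡_; refl; sym; trans; cong; cong₂; subst; subst₂)
open import Relation.Nullary.Decidable
  using (yes; no; ⌊_⌋; map′; _×-dec_; toWitness; fromWitness)
open import Relation.Nullary.Negation using (¬_)
open import Relation.Unary using (Decidable)
open +-*-Solver using (solve; con; _:=_; _:+_; _:*_; :-_)

-- Least witnesses and counting with duplicate-free lists

minimal : ∀ {P : ℕ → Set} → Decidable P → ∀ {ℓ} → P ℓ →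
          ∃[ d ] (P d × (∀ {m} → P m → d ℕ.≤ m))
minimal P? {ℓ} p with P? 0 | ℓ
... | yes p₀ | _     = 0 , p₀ , λ _ → z≤n
... | no ¬p₀ | zero  = ⊥-elim (¬p₀ p)
... | no ¬p₀ | suc _ =
  let (d , pd , least) = minimal (P? ∘ suc) p
  in suc d , pd , λ { {zero} q → ⊥-elim (¬p₀ q) ; {suc _} q → s≤s (least q) }

-- The head of `xs` occurs somewhere in `ys` and is cut out there; by uniqueness the tail of `xs`
-- never refers to the removed position.
unique∧⊆⇒length≤ : ∀ {A : Set} {xs ys : List A} → Unique xs → xs ⊆ ys → length xs ℕ.≤ length ys
unique∧⊆⇒length≤ []                       sub = z≤n
unique∧⊆⇒length≤ {xs = x ∷ xs} (x∉xs ∷ unique) sub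
  with (as , bs , refl) ← ∈-∃++ (sub (here refl)) =
    subst (suc (length xs) ℕ.≤_) (sym (ListP.length-++-sucʳ as x bs))
      (s≤s (unique∧⊆⇒length≤ unique sub′))
  where
  sub′ : xs ⊆ as ++ bs
  sub′ y∈xs with ∈-++⁻ as (sub (there y∈xs))
  ... | inj₁ y∈as         = ∈-++⁺ˡ y∈as
  ... | inj₂ (there y∈bs) = ∈-++⁺ʳ as y∈bs
  ... | inj₂ (here y≡x)   = ⊥-elim (All.lookup x∉xs y∈xs (sym y≡x))

-- Walks of bounded length, distances and stretch

WalkWithin : ∀ {n} → Graph n → Fin n → Fin n → ℕ → Set
WalkWithin G u v b = ∃[ ℓ ] (ℓ ℕ.≤ b × Walk G u v ℓ)

module _ {n} {G : Graph n} where

  Adj-sym : ∀ {u v} → Adj G u v → Adj G v u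
  Adj-sym {u} {v} = subst T (adj-sym G u v)

  _++ʷ_ : ∀ {u v w ℓ m} → Walk G u v ℓ → Walk G v w m → Walk G u w (ℓ ℕ.+ m)
  []      ++ʷ q = q
  (e ∷ p) ++ʷ q = e ∷ (p ++ʷ q)

  appendWithin : ∀ {u v w b c} → WalkWithin G u v b → WalkWithin G v w c → WalkWithin G u w (b ℕ.+ c)
  appendWithin (ℓ , ℓ≤b , p) (m , m≤c , q) = ℓ ℕ.+ m , ℕP.+-mono-≤ ℓ≤b m≤c , p ++ʷ q

  edgeWithin : ∀ {u v} → Adj G u v → WalkWithin G u v 1
  edgeWithin e = 1 , ℕP.≤-refl , e ∷ []

  reverseWithin : ∀ {u v b} → WalkWithin G u v b → WalkWithin G v u b
  reverseWithin (ℓ , ℓ≤b , p) = let (m , m≤ℓ , q) = go p in m , ℕP.≤-trans m≤ℓ ℓ≤b , q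
    where
    go : ∀ {u v ℓ} → Walk G u v ℓ → WalkWithin G v u ℓ
    go []      = 0 , z≤n , []
    go (_∷_ {ℓ = ℓ} e p) =
      subst (WalkWithin G _ _) (ℕP.+-comm ℓ 1) (appendWithin (go p) (edgeWithin (Adj-sym e)))

  weakenWithin : ∀ {u v b c} → b ℕ.≤ c → WalkWithin G u v b → WalkWithin G u v c
  weakenWithin b≤c (ℓ , ℓ≤b , p) = ℓ , ℕP.≤-trans ℓ≤b b≤c , p

  walk? : ∀ u v → Decidable (Walk G u v)
  walk? u v zero    = map′ (λ { refl → [] }) (λ { [] → refl }) (u FinP.≟ v)
  walk? u v (suc ℓ) =
    map′ (λ { (_ , e , p) → e ∷ p }) (λ { (e ∷ p) → _ , e , p })
      (FinP.any? (λ w → T? (adj G u w) ×-dec walk? w v ℓ))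

  -- `IsDistance` asks for an attained minimum. It is found by searching lengths upwards from 0,
  -- since the existence of a walk of a given length is decidable.
  distanceWithin : ∀ {u v b} → WalkWithin G u v b → ∃[ d ] (IsDistance G u v d × d ℕ.≤ b)
  distanceWithin (ℓ , ℓ≤b , p) =
    let (d , q , least) = minimal (walk? _ _) p
    in d , (q , least) , ℕP.≤-trans (least p) ℓ≤b

module _ {n} {G H : Graph n} where

  mapWithin : G ⊆ᴳ H → ∀ {u v b} → WalkWithin G u v b → WalkWithin H u v b
  mapWithin sub (ℓ , ℓ≤b , p) = ℓ , ℓ≤b , go p
    where
    go : ∀ {u v ℓ} → Walk G u v ℓ → Walk H u v ℓ
    go []      = []
    go (e ∷ p) = sub e ∷ go p

  -- Replacing every edge of a shortest walk of `G` by at most `α` edges of `H` multiplies its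
  -- length by at most `α`, so stretch need only be checked on edges.
  edgewise⇒spanner : ∀ {α} → H ⊆ᴳ G → (∀ {u v} → Adj G u v → WalkWithin H u v α) → IsSpanner α H G
  edgewise⇒spanner {α} sub short = sub , λ u v (p , _) → distanceWithin (stretch p)
    where
    stretch : ∀ {u v ℓ} → Walk G u v ℓ → WalkWithin H u v (α *ℕ ℓ)
    stretch []                = 0 , z≤n , []
    stretch (_∷_ {ℓ = ℓ} e p) =
      subst (WalkWithin H _ _) (sym (ℕP.*-suc α ℓ)) (appendWithin (short e) (stretch p))

-- Subgraphs cut out by lists of vertex pairs

Pairs : ℕ → Set
Pairs n = List (Fin n × Fin n)

_≟ᴾ_ : ∀ {n} → DecidableEquality (Fin n × Fin n)
_≟ᴾ_ = ProductP.≡-dec FinP._≟_ FinP._≟_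

module _ {n} (G : Graph n) where

  joined : Pairs n → Fin n → Fin n → Bool
  joined E u v = ⌊ _∈?_ _≟ᴾ_ (u , v) E ⌋ ∨ ⌊ _∈?_ _≟ᴾ_ (v , u) E ⌋

  -- The conjunction with `adj G` yields an irreflexive subgraph of `G` for every list `E`, so the
  -- trees built below carry no proof that their pairs are edges.
  restrict : Pairs n → Graph n
  restrict E = record
    { adj        = λ u v → adj G u v ∧ joined E u v
    ; adj-sym    = λ u v → cong₂ _∧_ (adj-sym G u v)
                     (∨-comm ⌊ _∈?_ _≟ᴾ_ (u , v) E ⌋ ⌊ _∈?_ _≟ᴾ_ (v , u) E ⌋)
    ; adj-irrefl = λ u → cong (_∧ joined E u u) (adj-irrefl G u)
    }

  restrict⁻ : ∀ E {u v} → Adj (restrict E) u v → Adj G u v × ((u , v) ∈ E ⊎ (v , u) ∈ E)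
  restrict⁻ E {u} {v} e with Equivalence.to (T-∧ {x = adj G u v}) e
  ... | a , j with Equivalence.to (T-∨ {x = ⌊ _∈?_ _≟ᴾ_ (u , v) E ⌋}) j
  ...   | inj₁ uv = a , inj₁ (toWitness uv)
  ...   | inj₂ vu = a , inj₂ (toWitness vu)

  restrict⁺ : ∀ E {u v} → Adj G u v → (u , v) ∈ E ⊎ (v , u) ∈ E → Adj (restrict E) u v
  restrict⁺ E {u} {v} a j = Equivalence.from (T-∧ {x = adj G u v})
    (a , Equivalence.from (T-∨ {x = ⌊ _∈?_ _≟ᴾ_ (u , v) E ⌋}) ([ inj₁ ∘ fromWitness , inj₂ ∘ fromWitness ]′ j))

  restrict-⊆ : ∀ E → restrict E ⊆ᴳ G
  restrict-⊆ E = proj₁ ∘ restrict⁻ E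

  restrict-mono : ∀ {E F} → E ⊆ F → restrict E ⊆ᴳ restrict F
  restrict-mono {E} {F} E⊆F e with restrict⁻ E e
  ... | a , inj₁ uv = restrict⁺ F a (inj₁ (E⊆F uv))
  ... | a , inj₂ vu = restrict⁺ F a (inj₂ (E⊆F vu))

  -- An edge is listed in #edges with its smaller endpoint first, while a
  -- pair of E may have either order; sorting the pairs of E aligns the two.
  #edges-restrict : ∀ E → #edges (restrict E) ℕ.≤ length E
  #edges-restrict E = subst (#edges (restrict E) ℕ.≤_) (ListP.length-map sort E)
    (unique∧⊆⇒length≤
      (UniqueP.filter⁺ _ (UniqueP.cartesianProduct⁺ (UniqueP.allFin⁺ n) (UniqueP.allFin⁺ n)))
      sub)
    where
    sort : Fin n × Fin n → Fin n × Fin n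
    sort (u , v) with u FinP.<? v
    ... | yes _ = u , v
    ... | no  _ = v , u
    sort-< : ∀ {u v} → T ⌊ u FinP.<? v ⌋ → sort (u , v) ≡ (u , v)
    sort-< {u} {v} t with u FinP.<? v
    ... | yes _ = refl
    sort-> : ∀ {u v} → T ⌊ u FinP.<? v ⌋ → sort (v , u) ≡ (u , v)
    sort-> {u} {v} t with v FinP.<? u
    ... | no _    = refl
    ... | yes v<u = ⊥-elim (FinP.<-asym (toWitness t) v<u)
    sub : edges (restrict E) ⊆ map sort E
    sub {u , v} uv∈ with ∈-filter⁻ _ {xs = cartesianProduct (allFin n) (allFin n)} uv∈
    ... | _ , t with Equivalence.to (T-∧ {x = ⌊ u FinP.<? v ⌋}) t
    ...   | u<v , e with restrict⁻ E e
    ...     | _ , inj₁ uv = subst (_∈ map sort E) (sort-< u<v) (∈-map⁺ sort uv)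
    ...     | _ , inj₂ vu = subst (_∈ map sort E) (sort-> u<v) (∈-map⁺ sort vu)

-- Naturals among the rationals, powers and roots

ι : ℕ → ℚ
ι n = fromℤ (+ n)

ι-* : ∀ m n → ι (m ℕ.* n) ≡ ι m ℚ.* ι n
ι-* m n = trans (sym (ℚP.↥p/↧p≡p (ι (m ℕ.* n)))) (cong (ℚ._/ 1) (ℤP.pos-* m n))

ι-+ : ∀ m n → ι (m ℕ.+ n) ≡ ι m ℚ.+ ι n
ι-+ m n = trans (sym (ℚP.↥p/↧p≡p (ι (m ℕ.+ n))))
  (cong (ℚ._/ 1) (sym (cong₂ ℤ._+_ (ℤP.*-identityʳ (+ m)) (ℤP.*-identityʳ (+ n)))))

ι-^ : ∀ m k → ι (m ℕ.^ k) ≡ ι m ^ℚ k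
ι-^ m zero    = refl
ι-^ m (suc k) = trans (ι-* m (m ℕ.^ k)) (cong (ι m ℚ.*_) (ι-^ m k))

ι-mono : ∀ {m n} → m ℕ.≤ n → ι m ℚ.≤ ι n
ι-mono m≤n = ℚ.*≤* (ℤP.*-monoʳ-≤-nonNeg (+ 1) (ℤ.+≤+ m≤n))

0≤ι : ∀ n → 0ℚ ℚ.≤ ι n
0≤ι n = ι-mono z≤n

0≤1 : 0ℚ ℚ.≤ 1ℚ
0≤1 = 0≤ι 1

*-monoˡ : ∀ {p q r} → 0ℚ ℚ.≤ r → p ℚ.≤ q → r ℚ.* p ℚ.≤ r ℚ.* q
*-monoˡ {r = r} 0≤r = ℚP.*-monoˡ-≤-nonNeg r {{ℚ.nonNegative 0≤r}}

*-monoʳ : ∀ {p q r} → 0ℚ ℚ.≤ r → p ℚ.≤ q → p ℚ.* r ℚ.≤ q ℚ.* r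
*-monoʳ {r = r} 0≤r = ℚP.*-monoʳ-≤-nonNeg r {{ℚ.nonNegative 0≤r}}

0≤* : ∀ {p q} → 0ℚ ℚ.≤ p → 0ℚ ℚ.≤ q → 0ℚ ℚ.≤ p ℚ.* q
0≤* {p} {q} 0≤p 0≤q = subst (ℚ._≤ p ℚ.* q) (ℚP.*-zeroʳ p) (*-monoˡ 0≤p 0≤q)

0≤+ : ∀ {p q} → 0ℚ ℚ.≤ p → 0ℚ ℚ.≤ q → 0ℚ ℚ.≤ p ℚ.+ q
0≤+ = ℚP.+-mono-≤

0≤^ : ∀ {p} k → 0ℚ ℚ.≤ p → 0ℚ ℚ.≤ p ^ℚ k
0≤^ zero    0≤p = 0≤1
0≤^ (suc k) 0≤p = 0≤* 0≤p (0≤^ k 0≤p)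

^ℚ-mono-< : ∀ {p q} k → 0ℚ ℚ.≤ p → p ℚ.< q → p ^ℚ suc k ℚ.< q ^ℚ suc k
^ℚ-mono-< {p} {q} zero 0≤p p<q = ℚP.*-monoˡ-<-pos 1ℚ p<q
^ℚ-mono-< {p} {q} (suc k) 0≤p p<q = ℚP.≤-<-trans
  (*-monoʳ (0≤^ (suc k) 0≤p) (ℚP.<⇒≤ p<q))
  (ℚP.*-monoʳ-<-pos q {{ℚ.positive (ℚP.≤-<-trans 0≤p p<q)}} (^ℚ-mono-< k 0≤p p<q))

^ℚ-cancel-≤ : ∀ {p q} k .{{_ : NonZero k}} → 0ℚ ℚ.≤ q → p ^ℚ k ℚ.≤ q ^ℚ k → p ℚ.≤ q
^ℚ-cancel-≤ (suc k) 0≤q h = ℚP.≮⇒≥ (λ q<p → ℚP.<-irrefl refl (ℚP.<-≤-trans (^ℚ-mono-< k 0≤q q<p) h))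

^ℚ-distrib-* : ∀ p q k → (p ℚ.* q) ^ℚ k ≡ p ^ℚ k ℚ.* q ^ℚ k
^ℚ-distrib-* p q zero    = refl
^ℚ-distrib-* p q (suc k) = trans (cong (p ℚ.* q ℚ.*_) (^ℚ-distrib-* p q k))
  (solve 4 (λ p q a b → p :* q :* (a :* b) := p :* a :* (q :* b)) refl p q (p ^ℚ k) (q ^ℚ k))

-- Both sides are compared through their `k`-th powers: a^k ≤ n b^k ≤ (t b)^k. This turns growth by
-- a factor n^{1/k} into growth by the rational `t`.
root-bound : ∀ k .{{_ : NonZero k}} {n a b t} → 0ℚ ℚ.≤ t → ι n ℚ.≤ t ^ℚ k →
             a ℕ.^ k ℕ.≤ n ℕ.* b ℕ.^ k → ι a ℚ.≤ t ℚ.* ι b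
root-bound k {n} {a} {b} {t} 0≤t n≤tᵏ aᵏ≤nbᵏ = ^ℚ-cancel-≤ k (0≤* 0≤t (0≤ι b)) (begin
  ι a ^ℚ k               ≡⟨ ι-^ a k ⟨
  ι (a ℕ.^ k)            ≤⟨ ι-mono aᵏ≤nbᵏ ⟩
  ι (n ℕ.* b ℕ.^ k)      ≡⟨ ι-* n (b ℕ.^ k) ⟩
  ι n ℚ.* ι (b ℕ.^ k)    ≤⟨ *-monoʳ (0≤ι (b ℕ.^ k)) n≤tᵏ ⟩
  t ^ℚ k ℚ.* ι (b ℕ.^ k) ≡⟨ cong (t ^ℚ k ℚ.*_) (ι-^ b k) ⟩
  t ^ℚ k ℚ.* ι b ^ℚ k    ≡⟨ ^ℚ-distrib-* t (ι b) k ⟨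
  (t ℚ.* ι b) ^ℚ k       ∎)
  where open ℚP.≤-Reasoning

-- k + 1 consecutive steps, each by a factor above n^{1/(k+1)}, would lead
-- beyond n.
slow-step : ∀ k n (a : ℕ → ℕ) → 1 ℕ.≤ a 0 → (∀ i → a i ℕ.≤ n) →
            ∃[ i ] (i ℕ.≤ k × a (suc i) ℕ.^ suc k ℕ.≤ n ℕ.* a i ℕ.^ suc k)
slow-step k n a 1≤a₀ a≤n =
  search k 0 refl (ℕP.≤-trans (ℕP.≤-reflexive (sym (ℕP.^-zeroˡ (suc k)))) (ℕP.^-monoˡ-≤ (suc k) 1≤a₀))
  where
  search : ∀ j i → i ℕ.+ j ≡ k → n ℕ.^ i ℕ.≤ a i ℕ.^ suc k →
           ∃[ i ] (i ℕ.≤ k × a (suc i) ℕ.^ suc k ℕ.≤ n ℕ.* a i ℕ.^ suc k)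
  -- The last step is always slow: a(k+1)^(k+1) ≤ n^(k+1) = n · n^k ≤ n · a(k)^(k+1), the final
  -- inequality being the invariant `large`.
  search zero i i+0≡k large with refl ← trans (sym (ℕP.+-identityʳ i)) i+0≡k =
    i , ℕP.≤-refl , ℕP.≤-trans (ℕP.^-monoˡ-≤ (suc i) (a≤n (suc i))) (ℕP.*-monoʳ-≤ n large)
  search (suc j) i i+1+j≡k large with a (suc i) ℕ.^ suc k ℕP.≤? n ℕ.* a i ℕ.^ suc k
  ... | yes slow = i , subst (i ℕ.≤_) i+1+j≡k (ℕP.m≤m+n i (suc j)) , slow
  ... | no ¬slow = search j (suc i) (trans (sym (ℕP.+-suc i j)) i+1+j≡k)
    (ℕP.≤-trans (ℕP.*-monoʳ-≤ n large) (ℕP.<⇒≤ (ℕP.≰⇒> ¬slow)))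

-- Balls and their breadth-first trees

module _ {n} (G : Graph n) where

  -- `tree-size` stands in for being a tree: fewer edges than vertices. Its strictness also makes
  -- `inside` nonempty, so that deleting a ball shrinks the remaining list.
  record Ball (R : List (Fin n)) (v : Fin n) (i : ℕ) : Set where
    field
      inside outside : List (Fin n)
      tree           : Pairs n
      size           : length inside ℕ.+ length outside ≡ length R
      tree-size      : length tree ℕ.< length inside
      cover          : ∀ {w} → w ∈ R → w ∈ inside ⊎ w ∈ outside
      reach          : ∀ {w} → w ∈ inside → WalkWithin (restrict G tree) v w i

  open Ball

  -- One link per vertex of `near` preserves the edge count of a tree. The separation of `far` from
  -- `B` in `cover` ensures that no neighbour is missed by the next ball.
  record Frontier (B D : List (Fin n)) : Set where
    field
      near far : List (Fin n)
      links    : Pairs n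
      size     : length near ℕ.+ length far ≡ length D
      links≡   : length links ≡ length near
      linked   : ∀ {w} → w ∈ near → ∃[ u ] (u ∈ B × Adj G u w × (u , w) ∈ links)
      cover    : ∀ {w} → w ∈ D → w ∈ near ⊎ w ∈ far × (∀ {u} → u ∈ B → ¬ Adj G u w)

  open Frontier using (near; far; links; links≡; linked)

  frontier : ∀ B D → Frontier B D
  frontier B []      = record
    { near = [] ; far = [] ; links = [] ; size = refl ; links≡ = refl
    ; linked = λ () ; cover = λ () }
  frontier B (w ∷ D) with frontier B D | Any.any? (λ u → T? (adj G u w)) B
  ... | F | yes adjacent = let (u , u∈B , e) = find adjacent in record
    { near   = w ∷ near F
    ; far    = far F
    ; links  = (u , w) ∷ links F
    ; size   = cong suc (Frontier.size F)
    ; links≡ = cong suc (links≡ F)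
    ; linked = λ { (here refl) → u , u∈B , e , here refl
                 ; (there x∈)  → let (y , y∈B , f , l) = linked F x∈ in y , y∈B , f , there l }
    ; cover  = λ { (here refl) → inj₁ (here refl)
                 ; (there x∈)  → Sum.map₁ there (Frontier.cover F x∈) }
    }
  ... | F | no ¬adjacent = record
    { near   = near F
    ; far    = w ∷ far F
    ; links  = links F
    ; size   = trans (ℕP.+-suc (length (near F)) (length (far F))) (cong suc (Frontier.size F))
    ; links≡ = links≡ F
    ; linked = linked F
    ; cover  = λ { (here refl) → inj₂ (here refl , λ u∈B e → ¬adjacent (lose u∈B e))
                 ; (there x∈)  → Sum.map₂ (Product.map₁ there) (Frontier.cover F x∈) }
    }

  module _ {R v i} (b : Ball R v i) where

    private F = frontier (inside b) (outside b)

    grow : Ball R v (suc i)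
    grow = record
      { inside    = near F ++ inside b
      ; outside   = far F
      ; tree      = links F ++ tree b
      ; size      = sizes
      ; tree-size = tree-sizes
      ; cover     = covers
      ; reach     = [ far-reach , near-reach ]′ ∘ ∈-++⁻ (near F)
      }
      where
      open ℕP.≤-Reasoning
      sizes : length (near F ++ inside b) ℕ.+ length (far F) ≡ length R
      sizes = begin-equality
        length (near F ++ inside b) ℕ.+ length (far F)
          ≡⟨ cong (ℕ._+ length (far F)) (trans (ListP.length-++ (near F)) (ℕP.+-comm (length (near F)) _)) ⟩
        length (inside b) ℕ.+ length (near F) ℕ.+ length (far F)
          ≡⟨ ℕP.+-assoc (length (inside b)) _ _ ⟩
        length (inside b) ℕ.+ (length (near F) ℕ.+ length (far F))
          ≡⟨ cong (length (inside b) ℕ.+_) (Frontier.size F) ⟩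
        length (inside b) ℕ.+ length (outside b)
          ≡⟨ size b ⟩
        length R ∎
      tree-sizes : length (links F ++ tree b) ℕ.< length (near F ++ inside b)
      tree-sizes = begin-strict
        length (links F ++ tree b)                 ≡⟨ ListP.length-++ (links F) ⟩
        length (links F) ℕ.+ length (tree b)       <⟨ ℕP.+-mono-≤-< (ℕP.≤-reflexive (links≡ F)) (tree-size b) ⟩
        length (near F) ℕ.+ length (inside b)      ≡⟨ ListP.length-++ (near F) ⟨
        length (near F ++ inside b)                ∎
      covers : ∀ {w} → w ∈ R → w ∈ near F ++ inside b ⊎ w ∈ far F
      covers w∈R with cover b w∈R
      ... | inj₁ w∈inside = inj₁ (∈-++⁺ʳ (near F) w∈inside)
      ... | inj₂ w∈outside with Frontier.cover F w∈outside
      ...   | inj₁ w∈near      = inj₁ (∈-++⁺ˡ w∈near)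
      ...   | inj₂ (w∈far , _) = inj₂ w∈far
      near-reach : ∀ {w} → w ∈ inside b → WalkWithin (restrict G (links F ++ tree b)) v w (suc i)
      near-reach w∈ = weakenWithin (ℕP.n≤1+n i)
        (mapWithin (restrict-mono G (∈-++⁺ʳ (links F))) (reach b w∈))
      far-reach : ∀ {w} → w ∈ near F → WalkWithin (restrict G (links F ++ tree b)) v w (suc i)
      far-reach w∈ = let (u , u∈ , e , l) = linked F w∈ in
        subst (WalkWithin _ v _) (ℕP.+-comm i 1) (appendWithin
          (mapWithin (restrict-mono G (∈-++⁺ʳ (links F))) (reach b u∈))
          (edgeWithin (restrict⁺ G (links F ++ tree b) e (inj₁ (∈-++⁺ˡ l)))))

    tree-⊆-grow : tree b ⊆ tree grow
    tree-⊆-grow = ∈-++⁺ʳ (links F)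

    -- A neighbour still outside after `grow` would lie in `far`, which has no edge to the old ball.
    absorb : ∀ {u w} → u ∈ inside b → w ∈ R → Adj G u w → w ∈ inside grow
    absorb u∈ w∈R e with cover b w∈R
    ... | inj₁ w∈inside = ∈-++⁺ʳ (near F) w∈inside
    ... | inj₂ w∈outside with Frontier.cover F w∈outside
    ...   | inj₁ w∈near      = ∈-++⁺ˡ w∈near
    ...   | inj₂ (_ , apart) = ⊥-elim (apart u∈ e)

    -- The tree of the next ball joins the two ends of an edge leaving b
    -- through the centre v.
    detour : ∀ {u w} → u ∈ inside b → w ∈ R → Adj G u w →
             WalkWithin (restrict G (tree grow)) u w (i ℕ.+ suc i)
    detour u∈ w∈R e = appendWithin
      (reverseWithin (mapWithin (restrict-mono G tree-⊆-grow) (reach b u∈)))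
      (reach grow (absorb u∈ w∈R e))

  ball : ∀ v R i → Ball (v ∷ R) v i
  ball v R zero    = record
    { inside = v ∷ [] ; outside = R ; tree = [] ; size = refl ; tree-size = ℕP.≤-refl
    ; cover  = λ { (here refl) → inj₁ (here refl) ; (there w∈) → inj₂ w∈ }
    ; reach  = λ { (here refl) → 0 , z≤n , [] }
    }
  ball v R (suc i) = grow (ball v R i)

  -- Deleting balls one after another

  module _ (k : ℕ) where

    -- Here t runs over the rational upper bounds of n^{1/(k+1)}: few says
    -- that |tree| ≤ n^{1/(k+1)} |R|.
    record Sparse (R : List (Fin n)) : Set where
      field
        tree  : Pairs n
        few   : ∀ {t} → 0ℚ ℚ.≤ t → ι n ℚ.≤ t ^ℚ suc k → ι (length tree) ℚ.≤ t ℚ.* ι (length R)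
        short : ∀ {u w} → u ∈ R → w ∈ R → Adj G u w → WalkWithin (restrict G tree) u w (k ℕ.+ suc k)

    open Sparse using (few; short)

    module _ {R v i} (b : Ball R v i) (i≤k : i ℕ.≤ k)
             (slow : length (inside (grow b)) ℕ.^ suc k ℕ.≤ n ℕ.* length (inside b) ℕ.^ suc k)
             (rest : Sparse (outside b)) where

      private
        T₁ = tree (grow b)
        T₂ = Sparse.tree rest

      -- The tree of the grown ball is charged to `inside b` alone: by `slow` the grown ball is at
      -- most `t` times as large. The newly reached rim stays in `outside b`, where `rest` pays for
      -- it and covers the edges that avoid `inside b`.
      carve : Sparse R
      carve = record { tree = T₁ ++ T₂ ; few = sparse ; short = joins }
        where
        open ℚP.≤-Reasoning
        sparse : ∀ {t} → 0ℚ ℚ.≤ t → ι n ℚ.≤ t ^ℚ suc k → ι (length (T₁ ++ T₂)) ℚ.≤ t ℚ.* ι (length R)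
        sparse {t} 0≤t n≤tᵏ = begin
          ι (length (T₁ ++ T₂))
            ≡⟨ cong ι (ListP.length-++ T₁) ⟩
          ι (length T₁ ℕ.+ length T₂)
            ≡⟨ ι-+ (length T₁) (length T₂) ⟩
          ι (length T₁) ℚ.+ ι (length T₂)
            ≤⟨ ℚP.+-mono-≤
                 (ℚP.≤-trans (ι-mono (ℕP.<⇒≤ (tree-size (grow b)))) (root-bound (suc k) 0≤t n≤tᵏ slow))
                 (few rest 0≤t n≤tᵏ) ⟩
          t ℚ.* ι (length (inside b)) ℚ.+ t ℚ.* ι (length (outside b))
            ≡⟨ ℚP.*-distribˡ-+ t _ _ ⟨
          t ℚ.* (ι (length (inside b)) ℚ.+ ι (length (outside b)))
            ≡⟨ cong (t ℚ.*_) (ι-+ (length (inside b)) (length (outside b))) ⟨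
          t ℚ.* ι (length (inside b) ℕ.+ length (outside b))
            ≡⟨ cong (λ m → t ℚ.* ι m) (size b) ⟩
          t ℚ.* ι (length R) ∎

        leaving : ∀ {u w} → u ∈ inside b → w ∈ R → Adj G u w →
                  WalkWithin (restrict G (T₁ ++ T₂)) u w (k ℕ.+ suc k)
        leaving u∈ w∈R e = weakenWithin (ℕP.+-mono-≤ i≤k (s≤s i≤k))
          (mapWithin (restrict-mono G {T₁} ∈-++⁺ˡ) (detour b u∈ w∈R e))

        joins : ∀ {u w} → u ∈ R → w ∈ R → Adj G u w →
                WalkWithin (restrict G (T₁ ++ T₂)) u w (k ℕ.+ suc k)
        joins u∈R w∈R e with cover b u∈R | cover b w∈R
        ... | inj₁ u∈ | _       = leaving u∈ w∈R e
        ... | inj₂ _  | inj₁ w∈ = reverseWithin (leaving w∈ u∈R (Adj-sym {G = G} e))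
        ... | inj₂ u∈ | inj₂ w∈ = mapWithin (restrict-mono G (∈-++⁺ʳ T₁)) (short rest u∈ w∈ e)

    -- `m` is the fuel of the recursion; together with `m ≤ n` it bounds every ball by `n`, as
    -- `slow-step` requires.
    sparse-within : ∀ m R → length R ℕ.≤ m → m ℕ.≤ n → Sparse R
    sparse-within m [] _ _ = record
      { tree  = []
      ; few   = λ {t} _ _ → ℚP.≤-reflexive (sym (ℚP.*-zeroʳ t))
      ; short = λ ()
      }
    sparse-within (suc m) (v ∷ R) (s≤s R≤m) m<n =
      let (i , i≤k , slow) = slow-step k n (λ i → length (inside (ball v R i))) ℕP.≤-refl bounded-by-n
          b = ball v R i
      in carve b i≤k slow (sparse-within m (outside b) (outside≤m b) (ℕP.<⇒≤ m<n))
      where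
      bounded-by-n : ∀ i → length (inside (ball v R i)) ℕ.≤ n
      bounded-by-n i = ℕP.≤-trans
        (subst (length (inside (ball v R i)) ℕ.≤_) (size (ball v R i)) (ℕP.m≤m+n _ _))
        (ℕP.≤-trans (s≤s R≤m) m<n)
      outside≤m : ∀ {i} (b : Ball (v ∷ R) v i) → length (outside b) ℕ.≤ m
      -- The ball has at least one vertex, so at most `length R` of the `suc (length R)` remaining
      -- vertices survive.
      outside≤m b = ℕP.≤-pred (ℕP.≤-trans
        (ℕP.+-monoˡ-≤ (length (outside b)) (ℕP.≤-trans (s≤s z≤n) (tree-size b)))
        (ℕP.≤-trans (ℕP.≤-reflexive (size b)) (s≤s R≤m)))

-- The edge bound is stated for all rational `t`, so that each term of the Cauchy sequence of the
-- root can later supply its own `t`.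
sparse-spanner : ∀ {n} (G : Graph n) k .{{_ : NonZero k}} →
  Σ[ H ∈ Graph n ] (IsSpanner (2 *ℕ k ∸ 1) H G ×
    (∀ {t} → 0ℚ ℚ.≤ t → ι n ℚ.≤ t ^ℚ k → ι (#edges H) ℚ.≤ t ℚ.* ι n))
sparse-spanner {n} G (suc k) = restrict G tree
  , edgewise⇒spanner (restrict-⊆ G tree)
      -- The stretch `2 *ℕ suc k ∸ 1` reduces to `k + suc (k + 0)`.
      (λ {u} {v} e → subst (λ j → WalkWithin (restrict G tree) u v (k ℕ.+ suc j)) (sym (ℕP.+-identityʳ k))
        (short (∈-allFin u) (∈-allFin v) e))
  , λ {t} 0≤t n≤tᵏ → ℚP.≤-trans (ι-mono (#edges-restrict G tree))
      (subst (λ j → ι (length tree) ℚ.≤ t ℚ.* ι j) (ListP.length-tabulate {n = n} id) (few 0≤t n≤tᵏ))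
  where
  open Sparse (sparse-within G k n (allFin n) (ℕP.≤-reflexive (ListP.length-tabulate {n = n} id)) ℕP.≤-refl)

-- Termwise estimates for the two real bounds

recipℚ-inverseˡ : ∀ {q} → 0ℚ ℚ.< q → recipℚ q ℚ.* q ≡ 1ℚ
recipℚ-inverseˡ {q} 0<q with q ℚP.≟ 0ℚ
... | yes q≡0 = ⊥-elim (ℚP.<⇒≢ 0<q (sym q≡0))
... | no q≢0  = ℚP.*-inverseˡ q {{ℚ.≢-nonZero q≢0}}

0≤recipℚ : ∀ {q} → 0ℚ ℚ.< q → 0ℚ ℚ.≤ recipℚ q
0≤recipℚ {q} 0<q = ℚP.*-cancelʳ-≤-pos q {{ℚ.positive 0<q}}
  (subst₂ ℚ._≤_ (sym (ℚP.*-zeroˡ q)) (sym (recipℚ-inverseˡ 0<q)) 0≤1)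

p≤p+q : ∀ {p q} → 0ℚ ℚ.≤ q → p ℚ.≤ p ℚ.+ q
p≤p+q {p} {q} 0≤q = subst (ℚ._≤ p ℚ.+ q) (ℚP.+-identityʳ p) (ℚP.+-monoʳ-≤ p 0≤q)

0≤1/suc : ∀ i → 0ℚ ℚ.≤ + 1 ℚ./ suc i
0≤1/suc i = ℚP.nonNegative⁻¹ _ {{ℚP.normalize-nonNeg 1 (suc i)}}

n/i→0 : ∀ n {ε} → 0ℚ ℚ.< ε → ∃[ N ] (∀ {i} → N ℕ.≤ i → ι n ℚ.* (+ 1 ℚ./ suc i) ℚ.≤ ε)
-- For ε = (a+1)/(d+1) the inequality cross-multiplies to n (d+1) ≤ (a+1)(i+1).
n/i→0 n {ε@(ℚ.mkℚ ℤ.+[1+ a ] d _)} 0<ε = n ℕ.* suc d , λ {i} N≤i → ℚP.toℚᵘ-cancel-≤ (begin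
  ℚ.toℚᵘ (ι n ℚ.* (+ 1 ℚ./ suc i))
    ≃⟨ ℚP.toℚᵘ-homo-* (ι n) (+ 1 ℚ./ suc i) ⟩
  ℚ.toℚᵘ (ι n) ℚᵘ.* ℚ.toℚᵘ (+ 1 ℚ./ suc i)
    ≃⟨ ℚᵘP.*-congˡ {ℚ.toℚᵘ (ι n)} (ℚP.toℚᵘ-fromℚᵘ (+ 1 ℚᵘ./ suc i)) ⟩
  ℚ.toℚᵘ (ι n) ℚᵘ.* (+ 1 ℚᵘ./ suc i)
    ≤⟨ ℚᵘ.*≤* (subst₂ ℤ._≤_ (trans (ℤP.pos-* n (suc d)) (cong (ℤ._* + suc d) (sym (ℤP.*-identityʳ (+ n)))))
                            (ℤP.pos-* (suc a) (1 ℕ.* suc i))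
         (ℤ.+≤+ (ℕP.≤-trans N≤i (le i)))) ⟩
  ℚ.toℚᵘ ε ∎)
  where
  open ℚᵘP.≤-Reasoning
  le : ∀ i → i ℕ.≤ suc a ℕ.* (1 ℕ.* suc i)
  le i = ℕP.≤-trans (ℕP.n≤1+n i) (ℕP.≤-trans (ℕP.≤-reflexive (sym (ℕP.*-identityˡ (suc i)))) (ℕP.m≤n*m _ (suc a)))
n/i→0 n {ℚ.mkℚ (+ 0) d _}       (ℚ.*<* (ℤ.+<+ ()))
n/i→0 n {ℚ.mkℚ ℤ.-[1+ a ] d _} (ℚ.*<* ())

-- Since r = 1/(c - 1), c r = 1 + r and A = n ρ + r n ρ ≥ n ρ. The rounding error n h is absorbed
-- twice: by ε in the bound on `m`, and by 1 in n ≤ A + 1, which makes the term δ (A - (n - 1))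
-- nonnegative.
few-edges-pointwise : ∀ {m n c δ ρ h r ε} → 0ℚ ℚ.≤ δ → 0ℚ ℚ.≤ r → r ℚ.* (c ℚ.+ ℚ.- 1ℚ) ≡ 1ℚ →
             0ℚ ℚ.≤ n ℚ.* ρ → m ℚ.≤ (ρ ℚ.+ h) ℚ.* n → n ℚ.≤ (ρ ℚ.+ h) ℚ.* n →
             n ℚ.* h ℚ.≤ ε → n ℚ.* h ℚ.≤ 1ℚ →
             m ℚ.≤ (1ℚ ℚ.+ δ) ℚ.* (c ℚ.* n ℚ.* ρ ℚ.* r) ℚ.+ ℚ.- (δ ℚ.* (n ℚ.+ ℚ.- 1ℚ)) ℚ.+ ε
few-edges-pointwise {m} {n} {c} {δ} {ρ} {h} {r} {ε} 0≤δ 0≤r rc 0≤nρ m≤ n≤ nh≤ε nh≤1 = begin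
  m
    ≤⟨ m≤ ⟩
  (ρ ℚ.+ h) ℚ.* n
    ≤⟨ below nh≤ε ⟩
  A ℚ.+ ε
    ≤⟨ p≤p+q (0≤* 0≤δ 0≤slack) ⟩
  A ℚ.+ ε ℚ.+ δ ℚ.* (A ℚ.+ 1ℚ ℚ.+ ℚ.- n)
    ≡⟨ solve 4 (λ A ε δ n → A :+ ε :+ δ :* (A :+ con 1ℚ :+ :- n)
                 := (con 1ℚ :+ δ) :* A :+ :- (δ :* (n :+ :- con 1ℚ)) :+ ε) refl A ε δ n ⟩
  (1ℚ ℚ.+ δ) ℚ.* A ℚ.+ ℚ.- (δ ℚ.* (n ℚ.+ ℚ.- 1ℚ)) ℚ.+ ε ∎
  where
  open ℚP.≤-Reasoning
  A = c ℚ.* n ℚ.* ρ ℚ.* r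
  nρ≤A : n ℚ.* ρ ℚ.≤ A
  nρ≤A = begin
    n ℚ.* ρ
      ≤⟨ p≤p+q (0≤* 0≤r 0≤nρ) ⟩
    n ℚ.* ρ ℚ.+ r ℚ.* (n ℚ.* ρ)
      ≡⟨ cong (ℚ._+ r ℚ.* (n ℚ.* ρ)) (ℚP.*-identityˡ (n ℚ.* ρ)) ⟨
    1ℚ ℚ.* (n ℚ.* ρ) ℚ.+ r ℚ.* (n ℚ.* ρ)
      ≡⟨ cong (λ x → x ℚ.* (n ℚ.* ρ) ℚ.+ r ℚ.* (n ℚ.* ρ)) rc ⟨
    r ℚ.* (c ℚ.+ ℚ.- 1ℚ) ℚ.* (n ℚ.* ρ) ℚ.+ r ℚ.* (n ℚ.* ρ)
      ≡⟨ solve 4 (λ c n ρ r → r :* (c :+ :- con 1ℚ) :* (n :* ρ) :+ r :* (n :* ρ) := c :* n :* ρ :* r)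
           refl c n ρ r ⟩
    A ∎
  below : ∀ {x} → n ℚ.* h ℚ.≤ x → (ρ ℚ.+ h) ℚ.* n ℚ.≤ A ℚ.+ x
  below {x} nh≤x = begin
    (ρ ℚ.+ h) ℚ.* n        ≡⟨ solve 3 (λ ρ h n → (ρ :+ h) :* n := n :* ρ :+ n :* h) refl ρ h n ⟩
    n ℚ.* ρ ℚ.+ n ℚ.* h    ≤⟨ ℚP.+-mono-≤ nρ≤A nh≤x ⟩
    A ℚ.+ x                ∎
  0≤slack : 0ℚ ℚ.≤ A ℚ.+ 1ℚ ℚ.+ ℚ.- n
  0≤slack = subst (ℚ._≤ A ℚ.+ 1ℚ ℚ.+ ℚ.- n) (ℚP.+-inverseʳ n)
    (ℚP.+-monoˡ-≤ (ℚ.- n) (ℚP.≤-trans n≤ (below nh≤1)))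

-- Here `x` is 1/c and `s` is 1/(1 + δ). As δ s + s = 1, the product falls short of 1 by exactly x δ
-- s + s.
success≤1 : ∀ {δ x s} → 0ℚ ℚ.≤ δ → 0ℚ ℚ.≤ x → 0ℚ ℚ.≤ s → s ℚ.* (1ℚ ℚ.+ δ) ≡ 1ℚ →
            (1ℚ ℚ.+ ℚ.- (1ℚ ℚ.* x)) ℚ.* (δ ℚ.* s) ℚ.≤ 1ℚ
success≤1 {δ} {x} {s} 0≤δ 0≤x 0≤s s-inv = begin
  (1ℚ ℚ.+ ℚ.- (1ℚ ℚ.* x)) ℚ.* (δ ℚ.* s)
    ≤⟨ p≤p+q (0≤+ (0≤* 0≤x (0≤* 0≤δ 0≤s)) 0≤s) ⟩
  (1ℚ ℚ.+ ℚ.- (1ℚ ℚ.* x)) ℚ.* (δ ℚ.* s) ℚ.+ (x ℚ.* (δ ℚ.* s) ℚ.+ s)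
    ≡⟨ solve 3 (λ δ x s → (con 1ℚ :+ :- (con 1ℚ :* x)) :* (δ :* s) :+ (x :* (δ :* s) :+ s)
                 := s :* (con 1ℚ :+ δ)) refl δ x s ⟩
  s ℚ.* (1ℚ ℚ.+ δ)
    ≡⟨ s-inv ⟩
  1ℚ ∎
  where open ℚP.≤-Reasoning

p<q⇒0<q-p : ∀ {p q} → p ℚ.< q → 0ℚ ℚ.< q ℚ.+ ℚ.- p
p<q⇒0<q-p {p} {q} p<q = subst (ℚ._< q ℚ.+ ℚ.- p) (ℚP.+-inverseʳ p) (ℚP.+-monoˡ-< (ℚ.- p) p<q)

eventually-below : ∀ {m x} → fromℕ m < x → ∃[ N ] (∀ {i} → N ℕ.≤ i → ι m ℚ.< seq x i)
eventually-below {m} (ε , 0<ε , N , m+ε≤x) = N , λ N≤i → ℚP.<-≤-trans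
  (subst (ℚ._< ι m ℚ.+ ε) (ℚP.+-identityʳ (ι m)) (ℚP.+-monoʳ-< (ι m) 0<ε)) (m+ε≤x N≤i)

-- The rounding in rootℚ (ρ) is compensated by h = 1 / (i + 1), so
-- (ρ + h)ᵏ > c n ≥ n and t = ρ + h bounds n^{1/k} from above.
few-edges : ∀ k .{{_ : NonZero k}} {m n} (c δ : ℝ) (c>3 : fromℕ 3 < c) → 0ℝ < δ →
  (∀ {t} → 0ℚ ℚ.≤ t → ι n ℚ.≤ t ^ℚ k → ι m ℚ.≤ t ℚ.* ι n) →
  fromℕ m ≤ (1ℝ + δ) * ((c * fromℕ n) ^1+1/ k / (c - 1ℝ) [ c>3⇒c-1>0 {c} c>3 ]) - δ * (fromℕ n - 1ℝ)
few-edges k@(suc _) {m} {n} c δ c>3 δ>0 sparse {ε} 0<ε =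
  let (N₁ , 3<c)  = eventually-below {3} {c} c>3
      (N₂ , 0<δ)  = eventually-below {0} {δ} δ>0
      (N₃ , nh≤ε) = n/i→0 n 0<ε
      (N₄ , nh≤1) = n/i→0 n (ℚP.positive⁻¹ 1ℚ)
  in (N₁ ℕ.⊔ N₂) ℕ.⊔ (N₃ ℕ.⊔ N₄) , λ {i} N≤i →
    let N₁₂≤i = ℕP.m⊔n≤o⇒m≤o (N₁ ℕ.⊔ N₂) (N₃ ℕ.⊔ N₄) N≤i
        N₃₄≤i = ℕP.m⊔n≤o⇒n≤o (N₁ ℕ.⊔ N₂) (N₃ ℕ.⊔ N₄) N≤i
    in pointwise i (3<c (ℕP.m⊔n≤o⇒m≤o N₁ N₂ N₁₂≤i)) (0<δ (ℕP.m⊔n≤o⇒n≤o N₁ N₂ N₁₂≤i))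
            (nh≤ε (ℕP.m⊔n≤o⇒m≤o N₃ N₄ N₃₄≤i)) (nh≤1 (ℕP.m⊔n≤o⇒n≤o N₃ N₄ N₃₄≤i))
  where
  pointwise : ∀ i → ι 3 ℚ.< seq c i → 0ℚ ℚ.< seq δ i →
       ι n ℚ.* (+ 1 ℚ./ suc i) ℚ.≤ ε → ι n ℚ.* (+ 1 ℚ./ suc i) ℚ.≤ 1ℚ →
       ι m ℚ.≤ (1ℚ ℚ.+ seq δ i) ℚ.*
                 (seq c i ℚ.* ι n ℚ.* rootℚ k (seq c i ℚ.* ι n) i ℚ.* recipℚ (seq c i ℚ.+ ℚ.- 1ℚ))
               ℚ.+ ℚ.- (seq δ i ℚ.* (ι n ℚ.+ ℚ.- 1ℚ)) ℚ.+ ε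
  pointwise i 3<c 0<δ nh≤ε nh≤1 = few-edges-pointwise {c = seq c i} (ℚP.<⇒≤ 0<δ) (0≤recipℚ 0<c-1) (recipℚ-inverseˡ 0<c-1)
    (0≤* (0≤ι n) 0≤ρ) (sparse 0≤t n≤tᵏ) (root-bound k {n} 0≤t n≤tᵏ n^k≤) nh≤ε nh≤1
    where
    open ℚP.≤-Reasoning
    1≤c : 1ℚ ℚ.≤ seq c i
    1≤c = ℚP.≤-trans (ι-mono (s≤s (z≤n {2}))) (ℚP.<⇒≤ 3<c)
    0<c-1 = p<q⇒0<q-p (ℚP.≤-<-trans (ι-mono (s≤s (z≤n {2}))) 3<c)
    0≤ρ = rootℚ-nonNeg k (seq c i ℚ.* ι n) i
    t = rootℚ k (seq c i ℚ.* ι n) i ℚ.+ + 1 ℚ./ suc i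
    0≤t : 0ℚ ℚ.≤ t
    0≤t = 0≤+ 0≤ρ (0≤1/suc i)
    n≤tᵏ : ι n ℚ.≤ t ^ℚ k
    n≤tᵏ = begin
      ι n                ≡⟨ ℚP.*-identityˡ (ι n) ⟨
      1ℚ ℚ.* ι n         ≤⟨ *-monoʳ (0≤ι n) 1≤c ⟩
      seq c i ℚ.* ι n    ≤⟨ ℚP.<⇒≤ (rootℚ-upper k (seq c i ℚ.* ι n) i) ⟩
      t ^ℚ k             ∎
    n^k≤ : n ℕ.^ k ℕ.≤ n ℕ.* n ℕ.^ k
    -- Taken with both bases equal to `n`, `root-bound` gives n ≤ t n also for n = 0, where t ≥ 1
    -- can fail.
    n^k≤ = self n
      where
      self : ∀ n → n ℕ.^ k ℕ.≤ n ℕ.* n ℕ.^ k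
      self zero    = z≤n
      self (suc n) = ℕP.m≤n*m (suc n ℕ.^ k) (suc n)

success-bound : ∀ (c δ : ℝ) (c>3 : fromℕ 3 < c) (δ>0 : 0ℝ < δ) →
  (1ℝ - 1ℝ / c [ c>3⇒c>0 {c} c>3 ]) * (δ / (1ℝ + δ) [ δ>0⇒1+δ>0 {δ} δ>0 ]) ≤ 1ℝ
success-bound c δ c>3 δ>0 {ε} 0<ε =
  let (N₁ , 3<c) = eventually-below {3} {c} c>3
      (N₂ , 0<δ) = eventually-below {0} {δ} δ>0
  in N₁ ℕ.⊔ N₂ , λ {i} N≤i →
    let 0<δᵢ   = 0<δ (ℕP.m⊔n≤o⇒n≤o N₁ N₂ N≤i)
        0<c    = ℚP.≤-<-trans (0≤ι 3) (3<c (ℕP.m⊔n≤o⇒m≤o N₁ N₂ N≤i))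
        0<1+δᵢ = ℚP.<-≤-trans (ℚP.positive⁻¹ 1ℚ) (p≤p+q (ℚP.<⇒≤ 0<δᵢ))
    in ℚP.≤-trans
      (success≤1 {seq δ i} {recipℚ (seq c i)} (ℚP.<⇒≤ 0<δᵢ) (0≤recipℚ 0<c) (0≤recipℚ 0<1+δᵢ)
        (recipℚ-inverseˡ 0<1+δᵢ))
      (p≤p+q (ℚP.<⇒≤ 0<ε))

theorem1 :
    (k : ℕ) .{{_ : NonZero k}} (c δ : ℝ) (c>3 : fromℕ 3 < c) (δ>0 : 0ℝ < δ) →
    Σ[ alg ∈ (∀ {n} → Graph n → Randomized (Graph n)) ]
      (∀ {n} (G : Graph n) →
        Pr[ alg G ∈ (λ H →
              IsSpanner (2 *ℕ k ∸ 1) H G ×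
              fromℕ (#edges H) ≤
                (1ℝ + δ) * ((c * fromℕ n) ^1+1/ k / (c - 1ℝ) [ c>3⇒c-1>0 {c} c>3 ])
                  - δ * (fromℕ n - 1ℝ)) ]≥
          ((1ℝ - 1ℝ / c [ c>3⇒c>0 {c} c>3 ]) * (δ / (1ℝ + δ) [ δ>0⇒1+δ>0 {δ} δ>0 ])))
theorem1 k c δ c>3 δ>0 =
  (λ G → record { #seeds = 1 ; run = λ _ → proj₁ (sparse-spanner G k) }) ,
  λ {n} G → let (H , spanner , sparse) = sparse-spanner G k in
    -- The full seed set has one element out of one, so the probability to be bounded below is 1.
    ⊤ , (λ _ → spanner , few-edges k {#edges H} {n} c δ c>3 δ>0 sparse)
      , success-bound c δ c>3 δ>0
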